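{- If $G$ is a Type 3 bicyclic graph of order $n\ge 7$ with at least one leaf, then $\operatorname{CS}(G,x)\preceq \operatorname{CS}(B_n,x)$.
   Context: All graphs are finite, simple and undirected. A bicyclic graph is a connected graph $G$ with $|E(G)|=|V(G)|+1$. For integers $a,b,c\ge 0$ with at most one of them equal to $0$, $G_3(a,b,c)$ is the graph consisting of two vertices joined by three internally disjoint paths having $a$, $b$ and $c$ internal vertices respectively (so its order is $a+b+c+2$). A Type 3 bicyclic graph is a bicyclic graph containing some $G_3(a,b,c)$ as an induced subgraph. $B_n$ is the graph with vertices $c,a,b,w$ and $n-4$ further vertices, where $c$ is adjacent to all other vertices and the only other edges are $ab$ and $aw$. A connected set is a vertex subset inducing a connected subgraph; $S_k(G)$ is the number of connected sets of size $k$ and $\operatorname{CS}(G,x)=\sum_{k\ge1}S_k(G)x^k$. For polynomials $A(x)=\sum_{k=0}^n a_kx^k$, $B(x)=\sum_{k=0}^m b_kx^k$, write $B(x)\preceq A(x)$ if $m\le n$ and $b_k\le a_k$ for all $k$. -}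

module Defs where

open import Data.Bool using (Bool; true; false; _∧_; _∨_; not; if_then_else_)
open import Data.Nat using (ℕ; zero; suc; _+_; _≤_; _≡ᵇ_; _<ᵇ_)
open import Data.Fin using (Fin; toℕ)
open import Data.List using (List; []; _∷_; _++_; map; concatMap; length; upTo; allFin; foldr)
open import Data.Bool.ListAction using (any; all)
open import Data.Vec using (Vec; lookup) renaming ([] to []ᵛ; _∷_ to _∷ᵛ_)
open import Data.Product using (Σ; _×_; _,_)
open import Relation.Binary.PropositionalEquality using (_≡_)
open import Relation.Nullary using (¬_)
open import Function.Definitions using (Injective)

Adj : ℕ → Set
Adj n = Fin n → Fin n → Bool

IsSimple : ∀ {n} → Adj n → Set
IsSimple {n} G = (∀ i j → G i j ≡ G j i) × (∀ i → G i i ≡ false)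

countTrue : List Bool → ℕ
countTrue [] = 0
countTrue (true ∷ bs) = suc (countTrue bs)
countTrue (false ∷ bs) = countTrue bs

_==_ : ∀ {n} → Fin n → Fin n → Bool
u == v = toℕ u ≡ᵇ toℕ v

edgeCount : ∀ {n} → Adj n → ℕ
edgeCount {n} G =
  countTrue (concatMap (λ i → map (λ j → (toℕ i <ᵇ toℕ j) ∧ G i j) (allFin n)) (allFin n))

degree : ∀ {n} → Adj n → Fin n → ℕ
degree {n} G v = countTrue (map (G v) (allFin n))

HasLeaf : ∀ {n} → Adj n → Set
HasLeaf {n} G = Σ (Fin n) λ v → degree G v ≡ 1

chain : ∀ {n} → Adj n → (Fin n → Bool) → Fin n → List (Fin n) → Fin n → Bool
chain G S u [] v = u == v
chain G S u (w ∷ ws) v = G u w ∧ S w ∧ chain G S w ws v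

allLists : ∀ n → ℕ → List (List (Fin n))
allLists n zero = [] ∷ []
allLists n (suc l) = concatMap (λ w → map (w ∷_) (allLists n l)) (allFin n)

-- there is a walk inside S from u to v with fewer than n steps
-- (any path in an n-vertex graph has at most n - 1 edges)
reachable : ∀ {n} → Adj n → (Fin n → Bool) → Fin n → Fin n → Bool
reachable {n} G S u v = any (λ l → any (λ ws → chain G S u ws v) (allLists n l)) (upTo n)

connectedᵇ : ∀ {n} → Adj n → (Fin n → Bool) → Bool
connectedᵇ {n} G S =
  all (λ u → all (λ v → not (S u ∧ S v) ∨ reachable G S u v) (allFin n)) (allFin n)

IsConnected : ∀ {n} → Adj n → Set
IsConnected G = connectedᵇ G (λ _ → true) ≡ true

IsBicyclic : ∀ {n} → Adj n → Set
IsBicyclic {n} G = IsConnected G × edgeCount G ≡ n + 1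

allSubsets : ∀ n → List (Vec Bool n)
allSubsets zero = []ᵛ ∷ []
allSubsets (suc n) = map (true ∷ᵛ_) (allSubsets n) ++ map (false ∷ᵛ_) (allSubsets n)

sizeV : ∀ {n} → Vec Bool n → ℕ
sizeV []ᵛ = 0
sizeV (true ∷ᵛ bs) = suc (sizeV bs)
sizeV (false ∷ᵛ bs) = sizeV bs

Sk : ∀ {n} → ℕ → Adj n → ℕ
Sk {n} k G = countTrue (map (λ S → (sizeV S ≡ᵇ k) ∧ connectedᵇ G (lookup S)) (allSubsets n))

-- Polynomials with ℕ coefficients as coefficient lists [a₀, a₁, …, a_d].
Poly : Set
Poly = List ℕ

coeff : Poly → ℕ → ℕ
coeff [] k = 0
coeff (a ∷ as) zero = a
coeff (a ∷ as) (suc k) = coeff as k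

CS : ∀ {n} → Adj n → Poly
CS {n} G = 0 ∷ map (λ k → Sk (suc k) G) (upTo n)

_⪯_ : Poly → Poly → Set
B ⪯ A = (length B ≤ length A) × (∀ k → coeff B k ≤ coeff A k)

adjFromEdges : ∀ {n} → List (ℕ × ℕ) → Adj n
adjFromEdges es i j =
  any (λ { (u , v) → ((u ≡ᵇ toℕ i) ∧ (v ≡ᵇ toℕ j)) ∨ ((u ≡ᵇ toℕ j) ∧ (v ≡ᵇ toℕ i)) }) es

pathEdges : ℕ → ℕ → ℕ → ℕ → List (ℕ × ℕ)
pathEdges x y s zero = (x , y) ∷ []
pathEdges x y s (suc k) = (x , s) ∷ pathEdges s y (suc s) k

-- G₃(a,b,c): end vertices 0 and 1, three internally disjoint paths with
-- a, b, c internal vertices; order a + b + c + 2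
G3 : (a b c : ℕ) → Adj (a + b + c + 2)
G3 a b c = adjFromEdges (pathEdges 0 1 2 a ++ pathEdges 0 1 (2 + a) b ++ pathEdges 0 1 (2 + a + b) c)

AtMostOneZero : ℕ → ℕ → ℕ → Set
AtMostOneZero a b c = ¬ (a ≡ 0 × b ≡ 0) × ¬ (a ≡ 0 × c ≡ 0) × ¬ (b ≡ 0 × c ≡ 0)

InducedSub : ∀ {m n} → Adj m → Adj n → Set
InducedSub {m} {n} H G =
  Σ (Fin m → Fin n) λ f → Injective _≡_ _≡_ f × (∀ i j → H i j ≡ G (f i) (f j))

IsType3 : ∀ {n} → Adj n → Set
IsType3 G = IsBicyclic G ×
  Σ ℕ λ a → Σ ℕ λ b → Σ ℕ λ c → AtMostOneZero a b c × InducedSub (G3 a b c) G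

-- B_n: c = 0, a = 1, b = 2, w = 3, further vertices 4 … n-1;
-- c adjacent to all others, plus edges ab and aw.
B : (n : ℕ) → Adj n
B n = adjFromEdges ((1 , 2) ∷ (1 , 3) ∷ map (λ v → (0 , suc v)) (upTo (n Data.Nat.∸ 1)))

{-# OPTIONS --safe #-}
module Submission where

-- In Bₙ every set containing the centre is connected, so for k ≥ 3 it suffices to show
-- S_k(G) ≤ C(n-1, k-1), plus 1 when k = 3.  Two operations preserve such bounds by Pascal's rule.
-- Attaching a leaf v at u: a connected k-set through v contains u, so there are at most C(n-1, k-2)
-- of them.  Subdividing an edge by z: deleting z from a connected k-set leaves a connected
-- (k-1)-set of the smaller graph, so S_k(G') ≤ S_k(G) + S_{k-1}(G);
-- for k = 3 the increment is bounded by the degrees of the ends of the edge.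
-- Comparing |E(G)| = n + 1 with the edges of the theta subgraph shows that G arises from it by
-- attaching leaves.  If the theta graph has 4 vertices, its bound is trivial; if it has 5, the graphs
-- obtained after two leaves are checked by computation; if it has at least 6, the bound holds once one
-- leaf is attached, by contracting the theta graph to one on 6 vertices (keeping the vertex that
-- carries the leaf), where it is checked by computation.

open import Defs
open import Data.Bool using (Bool; true; false; _∧_; _∨_; not; if_then_else_; _xor_)
open import Data.Bool.ListAction using (any; all)
open import Data.Empty using (⊥; ⊥-elim)
open import Data.Fin using (Fin; zero; suc; toℕ; fromℕ<) renaming (_≟_ to _≟ᶠ_)
open import Data.Fin.Properties using (toℕ-injective; toℕ-fromℕ<; toℕ<n)
open import Data.List using (List; []; _∷_; _++_; map; length; upTo; allFin; concatMap; tabulate)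
open import Data.List.Membership.Propositional using (_∈_; _∉_; find; lose)
import Data.List.Membership.DecPropositional as DecMem
open import Data.List.Membership.Propositional.Properties
  using (∈-∃++; ∈-allFin; ∈-++⁺ˡ; ∈-++⁺ʳ; ∈-++⁻; ∈-map⁺; ∈-map⁻; ∈-upTo⁺; ∈-upTo⁻; ∈-concatMap⁺)
open import Data.List.Properties
  using (length-map; length-tabulate; length-++; ++-assoc; ++-identityʳ; map-tabulate; map-++; map-∘; map-cong)
import Data.List.Relation.Binary.Permutation.Setoid.Properties as Permₛ
open import Data.List.Relation.Binary.Permutation.Propositional
  using (_↭_; refl; prep; swap; trans; ↭-sym; ↭-reflexive; ↭⇒↭ₛ)
open import Data.List.Relation.Binary.Permutation.Propositional.Properties
  using (∈-resp-↭; ↭-length; shift; shifts; ++-comm; ++⁺; ++⁺ˡ; ↭-singleton-inv; ↭-empty-inv)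
import Data.List.Relation.Binary.Sublist.Propositional as Sub
open Sub using (_⊆_; _∷ʳ_; _∷_; [])
import Data.List.Relation.Binary.Sublist.Propositional.Properties as Subₚ
import Data.List.Relation.Unary.All as All
import Data.List.Relation.Unary.Any as Any
open import Data.List.Relation.Unary.Any using (Any; here; there; tail; any?)
open import Data.List.Relation.Unary.Unique.Propositional using (Unique; []; _∷_)
open import Data.List.Relation.Unary.Unique.Propositional.Properties using (Unique[x∷xs]⇒x∉xs; allFin⁺)
open import Data.Nat using (ℕ; zero; suc; _+_; _*_; _∸_; _≤_; _<_; z≤n; s≤s; s≤s⁻¹; _≡ᵇ_; _≤ᵇ_; _<ᵇ_)
open import Data.Nat.Properties hiding (_≟_)
open import Algebra.Properties.CommutativeSemigroup +-commutativeSemigroup using (interchange)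
open import Data.Nat.Solver using (module +-*-Solver)
open +-*-Solver using (solve; _:+_; _:*_; _:=_) renaming (con to lit)
open import Data.Product using (_×_; _,_; proj₁; proj₂; ∃)
open import Data.Sum using (_⊎_; inj₁; inj₂; [_,_]′)
open import Data.Unit using (tt)
open import Data.Vec using (Vec; lookup) renaming ([] to []ᵛ; _∷_ to _∷ᵛ_; tabulate to tabulateᵛ)
open import Data.Vec.Properties using (lookup∘tabulate; tabulate-cong)
open import Function using (_∘_; id; mk⇔)
open import Function.Definitions using (Injective)
open import Relation.Binary.Definitions using (DecidableEquality)
open import Relation.Binary.PropositionalEquality
  using (_≡_; _≢_; refl; sym; cong; cong₂; subst; subst₂; setoid; module ≡-Reasoning)
  renaming (trans to ≡-trans)
open import Relation.Nullary using (¬_; Dec; yes; no; does; contradiction; ¬?)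
open import Relation.Nullary.Decidable using (dec-true; dec-false; does-⇔; _×-dec_)

-- Counting sublists

-- Three obstacles shape the argument. A theta graph alone breaks the bound from five vertices on:
-- it is 2-connected, so it has n connected sets of size n - 1, against C(n-1, n-2) = n - 1. The
-- induction on subdivisions must therefore carry a prospective leaf along. At k = 3 Pascal's rule
-- would call for the bound at k = 2, which n + 1 edges violate. Triples thus form a separate
-- invariant, and the increment, at most 3 + 2 = 5, fits under |V| - 1 from six vertices on.
-- Finally, K_{2,3} with one leaf at a vertex of degree three has 9 + 3 = 12 connected triples,
-- while B_6 has 11. Over five-vertex theta graphs the induction can start only at seven vertices,
-- with both leaves that n ≥ 7 provides. Every bound is stated for an arbitrary predicate implying
-- connectedness, because deleting a vertex z sends the sets through z to some family of connected
-- sets of the smaller graph, in general not to all of them.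

binom : ℕ → ℕ → ℕ
binom n       zero    = 1
binom zero    (suc k) = 0
binom (suc n) (suc k) = binom n k + binom n (suc k)

binom-1 : ∀ n → binom n 1 ≡ n
binom-1 zero    = refl
binom-1 (suc n) = cong suc (binom-1 n)

bit : Bool → ℕ
bit true  = 1
bit false = 0

bit≤1 : ∀ b → bit b ≤ 1
bit≤1 true  = s≤s z≤n
bit≤1 false = z≤n

-- cnt p k L is the number of sublists of L of length k satisfying p.
cnt : {A : Set} → (List A → Bool) → ℕ → List A → ℕ
cnt p zero    _        = bit (p [])
cnt p (suc k) []       = 0
cnt p (suc k) (x ∷ xs) = cnt (p ∘ (x ∷_)) k xs + cnt p (suc k) xs

-- Asking for `P` only on sublists of `L` of length `k` lets facts about adjacency inside `L`
-- suffice; `forces-head` and `forces-tail` follow the two branches of `cnt`.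
Forces : {A : Set} → (List A → Bool) → (List A → Set) → ℕ → List A → Set
Forces p P k L = ∀ s → s ⊆ L → length s ≡ k → p s ≡ true → P s

-- Vertex sets are encoded as sublists, so reordering the vertices reorders the listing of each set;
-- predicates on sets must ignore this.
Inv : {A : Set} → (List A → Bool) → Set
Inv p = ∀ {s t} → s ↭ t → p s ≡ p t

module _ {A : Set} where

  []⊆_ : (L : List A) → [] ⊆ L
  []⊆ []      = []
  []⊆ (x ∷ L) = x ∷ʳ ([]⊆ L)

  forces-head : ∀ {p : List A → Bool} {P k x L} →
    Forces p P (suc k) (x ∷ L) → Forces (p ∘ (x ∷_)) (P ∘ (x ∷_)) k L
  forces-head F s s⊆L refl = F _ (refl ∷ s⊆L) refl

  forces-tail : ∀ {p : List A → Bool} {P k x L} → Forces p P k (x ∷ L) → Forces p P k L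
  forces-tail F s s⊆L = F s (_ ∷ʳ s⊆L)

  cnt-mono : ∀ (p q : List A → Bool) k L →
    Forces p (λ s → q s ≡ true) k L → cnt p k L ≤ cnt q k L
  cnt-mono p q zero L F with p [] in eq
  ... | false = z≤n
  ... | true rewrite F [] ([]⊆ L) refl eq = ≤-refl
  cnt-mono p q (suc k) []      F = z≤n
  cnt-mono p q (suc k) (x ∷ L) F =
    +-mono-≤ (cnt-mono _ _ k L (forces-head F)) (cnt-mono p q (suc k) L (forces-tail F))

  cnt-cong : ∀ (p q : List A → Bool) k L → (∀ s → p s ≡ q s) → cnt p k L ≡ cnt q k L
  cnt-cong p q zero    L       e = cong bit (e [])
  cnt-cong p q (suc k) []      e = refl
  cnt-cong p q (suc k) (x ∷ L) e =
    cong₂ _+_ (cnt-cong _ _ k L (e ∘ (x ∷_))) (cnt-cong p q (suc k) L e)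

  cnt≤binom : ∀ (p : List A → Bool) k L → cnt p k L ≤ binom (length L) k
  cnt≤binom p zero    L       = bit≤1 (p [])
  cnt≤binom p (suc k) []      = z≤n
  cnt≤binom p (suc k) (x ∷ L) = +-mono-≤ (cnt≤binom _ k L) (cnt≤binom p (suc k) L)

  cnt≡0 : ∀ (p : List A → Bool) k L → Forces p (λ _ → ⊥) k L → cnt p k L ≡ 0
  cnt≡0 p zero L F with p [] in eq
  ... | false = refl
  ... | true = ⊥-elim (F [] ([]⊆ L) refl eq)
  cnt≡0 p (suc k) []      F = refl
  cnt≡0 p (suc k) (x ∷ L) F =
    cong₂ _+_ (cnt≡0 _ k L (forces-head F)) (cnt≡0 p (suc k) L (forces-tail F))

  inv-cons : ∀ {p : List A → Bool} x → Inv p → Inv (p ∘ (x ∷_))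
  inv-cons x I r = I (prep x r)

  cnt-perm : ∀ {p : List A → Bool} k {L M} → Inv p → L ↭ M → cnt p k L ≡ cnt p k M
  cnt-perm zero    I r = refl
  cnt-perm (suc k) I refl = refl
  cnt-perm (suc k) I (prep x r) = cong₂ _+_ (cnt-perm k (inv-cons x I) r) (cnt-perm (suc k) I r)
  cnt-perm {p} (suc zero) {x ∷ y ∷ L} {y ∷ x ∷ M} I (swap x y r)
    rewrite cnt-perm {p} 1 I r = begin
      b x + (b y + t)  ≡⟨ +-assoc (b x) (b y) t ⟨
      b x + b y + t    ≡⟨ cong (_+ t) (+-comm (b x) (b y)) ⟩
      b y + b x + t    ≡⟨ +-assoc (b y) (b x) t ⟩
      b y + (b x + t)  ∎
    where open ≡-Reasoning
          b : A → ℕ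
          b z = bit (p (z ∷ []))
          t = cnt p 1 M
  -- Splitting on both heads gives four counts. Only the sets containing both swapped vertices are
  -- listed differently, and invariance of `p` identifies these.
  cnt-perm {p} (suc (suc k)) {x ∷ y ∷ L} {y ∷ x ∷ M} I (swap x y r)
    rewrite cnt-perm {p} (suc (suc k)) I r
          | cnt-perm (suc k) (inv-cons x I) r
          | cnt-perm (suc k) (inv-cons y I) r
          | cnt-perm k (inv-cons y (inv-cons x I)) r
          | cnt-cong _ _ k M (λ s → I (swap x y (refl {xs = s}))) = begin
      (a + b) + (c + d)  ≡⟨ interchange a b c d ⟩
      (a + c) + (b + d)  ∎
    where open ≡-Reasoning
          a = cnt (λ s → p (y ∷ x ∷ s)) k M
          b = cnt (λ s → p (x ∷ s)) (suc k) M
          c = cnt (λ s → p (y ∷ s)) (suc k) M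
          d = cnt p (suc (suc k)) M
  cnt-perm (suc k) I (trans r r') = ≡-trans (cnt-perm (suc k) I r) (cnt-perm (suc k) I r')

  cnt-map : {B : Set} (f : A → B) (p : List B → Bool) → ∀ k L →
    cnt p k (map f L) ≡ cnt (p ∘ map f) k L
  cnt-map f p zero    L       = refl
  cnt-map f p (suc k) []      = refl
  cnt-map f p (suc k) (x ∷ L) = cong₂ _+_ (cnt-map f _ k L) (cnt-map f p (suc k) L)

  cnt-split : ∀ (p q r : List A → Bool) k L →
    Forces p (λ s → q s ≡ true ⊎ r s ≡ true) k L → cnt p k L ≤ cnt q k L + cnt r k L
  cnt-split p q r zero L F with p [] in eq
  ... | false = z≤n
  ... | true with F [] ([]⊆ L) refl eq
  ...   | inj₁ e rewrite e = s≤s z≤n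
  ...   | inj₂ e rewrite e = m≤n+m 1 (bit (q []))
  cnt-split p q r (suc k) []      F = z≤n
  cnt-split p q r (suc k) (x ∷ L) F = begin
      cnt (p ∘ (x ∷_)) k L + cnt p (suc k) L
        ≤⟨ +-mono-≤ (cnt-split _ (q ∘ (x ∷_)) (r ∘ (x ∷_)) k L (forces-head F))
                    (cnt-split p q r (suc k) L (forces-tail F)) ⟩
      (a + b) + (c + d)  ≡⟨ interchange a b c d ⟩
      (a + c) + (b + d)  ∎
    where open ≤-Reasoning
          a = cnt (q ∘ (x ∷_)) k L
          b = cnt (r ∘ (x ∷_)) k L
          c = cnt q (suc k) L
          d = cnt r (suc k) L

  1≤cnt1 : ∀ (p : List A → Bool) {L u} → u ∈ L → p (u ∷ []) ≡ true → 1 ≤ cnt p 1 L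
  1≤cnt1 p (here refl) e rewrite e = s≤s z≤n
  1≤cnt1 p (there {x = x} h) e = ≤-trans (1≤cnt1 p h e) (m≤n+m _ (bit (p (x ∷ []))))

  2≤cnt1 : ∀ (p : List A → Bool) {L u w} → u ∈ L → w ∈ L → u ≢ w →
    p (u ∷ []) ≡ true → p (w ∷ []) ≡ true → 2 ≤ cnt p 1 L
  2≤cnt1 p (here refl) (here refl) n e e' = contradiction refl n
  2≤cnt1 p (here refl) (there w) n e e' rewrite e = s≤s (1≤cnt1 p w e')
  2≤cnt1 p (there u) (here refl) n e e' rewrite e' = s≤s (1≤cnt1 p u e)
  2≤cnt1 p (there {x = x} u) (there w) n e e' =
    ≤-trans (2≤cnt1 p u w n e e') (m≤n+m _ (bit (p (x ∷ []))))

  ∈[]-unique : ∀ {u w a : A} → u ∈ a ∷ [] → w ∈ a ∷ [] → u ≡ w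
  ∈[]-unique (here refl) (here refl) = refl

  ∉[] : ∀ {u : A} → u ∉ []
  ∉[] ()

  ⊆-∈ : ∀ {s L : List A} {u} → s ⊆ L → u ∈ s → u ∈ L
  ⊆-∈ = Sub.lookup

module _ {A : Set} (_≟_ : DecidableEquality A) where

  -- The other `j` elements are chosen among the remaining `length L ∸ 1`; if `u` does not occur in
  -- `L`, the count is zero.
  cnt-contains : ∀ (p : List A → Bool) j {L} u → Unique L →
    Forces p (u ∈_) (suc j) L → cnt p (suc j) L ≤ binom (length L ∸ 1) j
  cnt-contains p j {[]} u U F = z≤n
  cnt-contains p j {x ∷ L} u U@(_ ∷ U') F with u ≟ x
  ... | yes refl rewrite cnt≡0 p (suc j) L
          (λ s s⊆L e t → Unique[x∷xs]⇒x∉xs U (⊆-∈ s⊆L (F s (x ∷ʳ s⊆L) e t)))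
        | +-identityʳ (cnt (p ∘ (x ∷_)) j L) = cnt≤binom _ j L
  ... | no u≢x = rest j L U' F
    where
    rest : ∀ j L → Unique L → Forces p (u ∈_) (suc j) (x ∷ L) →
      cnt p (suc j) (x ∷ L) ≤ binom (length L) j
    rest zero L U' F rewrite cnt≡0 (p ∘ (x ∷_)) 0 L
        (λ { [] s⊆L _ t → ∉[] (tail u≢x (F (x ∷ []) (refl ∷ s⊆L) refl t)) })
      = cnt-contains p 0 u U' (forces-tail F)
    rest (suc j) [] U' F = z≤n
    -- Pascal's rule needs `length L ∸ 1` to be a true predecessor, hence the nonempty `L`.
    rest (suc j) L@(_ ∷ _) U' F = +-mono-≤
      (cnt-contains (p ∘ (x ∷_)) j u U' (λ s h e t → tail u≢x (forces-head F s h e t)))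
      (cnt-contains p (suc j) u U' (forces-tail F))

  cnt-pair : ∀ (p : List A → Bool) {L} u w → Unique L → u ≢ w →
    Forces p (λ s → u ∈ s × w ∈ s) 2 L → cnt p 2 L ≤ 1
  cnt-pair p {[]} u w U u≢w F = z≤n
  cnt-pair p {x ∷ L} u w U@(_ ∷ U') u≢w F with u ≟ x | w ≟ x
  ... | yes refl | yes refl = contradiction refl u≢w
  ... | yes refl | no w≢x rewrite cnt≡0 p 2 L
          (λ s s⊆L e t → Unique[x∷xs]⇒x∉xs U (⊆-∈ s⊆L (proj₁ (F s (x ∷ʳ s⊆L) e t))))
        | +-identityʳ (cnt (p ∘ (x ∷_)) 1 L) =
        cnt-contains _ 0 w U' (λ s h e t → tail w≢x (proj₂ (forces-head F s h e t)))
  ... | no u≢x | yes refl rewrite cnt≡0 p 2 L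
          (λ s s⊆L e t → Unique[x∷xs]⇒x∉xs U (⊆-∈ s⊆L (proj₂ (F s (x ∷ʳ s⊆L) e t))))
        | +-identityʳ (cnt (p ∘ (x ∷_)) 1 L) =
        cnt-contains _ 0 u U' (λ s h e t → tail u≢x (proj₁ (forces-head F s h e t)))
  ... | no u≢x | no w≢x rewrite cnt≡0 (p ∘ (x ∷_)) 1 L
          (λ { (a ∷ []) h e t → let f = forces-head F (a ∷ []) h refl t in
               u≢w (∈[]-unique (tail u≢x (proj₁ f)) (tail w≢x (proj₂ f))) })
      = cnt-pair p u w U' u≢w (forces-tail F)

-- Connected sets under leaves and subdivisions

-- Connectivity by cuts rather than walks, so that passing to a contraction needs no walk surgery.
Conn : {A : Set} → (A → A → Set) → List A → Set
Conn {A} E s = ∀ (P : A → Bool) → (∀ {u v} → u ∈ s → v ∈ s → E u v → P u ≡ P v) →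
  ∀ {u v} → u ∈ s → v ∈ s → P u ≡ P v

conn-mono : {A : Set} {E E' : A → A → Set} {s t : List A} →
  (∀ {u} → u ∈ s → u ∈ t) → (∀ {u} → u ∈ t → u ∈ s) →
  (∀ {u v} → u ∈ s → v ∈ s → E u v → E' u v) → Conn E s → Conn E' t
conn-mono st ts h C P cl u v =
  C P (λ a b e → cl (st a) (st b) (h a b e)) (ts u) (ts v)

conn-perm : {A : Set} {E E' : A → A → Set} {s t : List A} →
  (∀ {u v} → E' u v → E u v) → s ↭ t → Conn E' s → Conn E t
conn-perm h r = conn-mono (∈-resp-↭ r) (∈-resp-↭ (↭-sym r)) (λ _ _ → h)

dec-true⁻ : {P : Set} (d : Dec P) → does d ≡ true → P
dec-true⁻ (yes p) _ = p

∧-true⁻ : ∀ a {b} → a ∧ b ≡ true → a ≡ true × b ≡ true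
∧-true⁻ true e = refl , e

∧-true⁺ : ∀ {a b} → a ≡ true → b ≡ true → a ∧ b ≡ true
∧-true⁺ refl e = e

unique-tail : {A : Set} {x : A} {L : List A} → Unique (x ∷ L) → Unique L
unique-tail (_ ∷ u) = u

sublist-unique : {A : Set} {s L : List A} → s ⊆ L → Unique L → Unique s
sublist-unique []         U       = []
sublist-unique (_ ∷ʳ h)   (_ ∷ U) = sublist-unique h U
sublist-unique (refl ∷ h) (x ∷ U) =
  All.tabulate (λ m → All.lookup x (⊆-∈ h m)) ∷ sublist-unique h U

-- The triple {a, b, w}, the only connected set of size at least three in Bₙ that avoids the centre.
-- The allowance can be exhausted: two leaves at one vertex of degree three of K_{2,3} give 16 =
-- C(6,2) + 1 connected triples.
bonus : ℕ → ℕ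
bonus zero    = 1
bonus (suc _) = 0

Bound : {A : Set} → (A → A → Set) → List A → Set
Bound E L = ∀ j p → Inv p → Forces p (Conn E) (3 + j) L →
  cnt p (3 + j) L ≤ binom (length L ∸ 1) (2 + j) + bonus j

-- Stricter than `Bound` at size three: in `leafBound-step` it is added to the `length L ∸ 1` pairs
-- through `u`, and together they exhaust C(|L|, 2).
Bound₃ : {A : Set} → (A → A → Set) → List A → Set
Bound₃ E L = ∀ p → Inv p → Forces p (Conn E) 3 L → cnt p 3 L ≤ binom (length L ∸ 1) 2

-- The bound for the graph obtained by attaching a leaf at u:
-- p counts the connected sets avoiding the leaf, q those containing it.
LeafBound : {A : Set} → (A → A → Set) → A → List A → Set
LeafBound E u L = ∀ j p q → Inv p → Inv q → Forces p (Conn E) (3 + j) L →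
  Forces q (λ s → Conn E s × u ∈ s) (2 + j) L →
  cnt p (3 + j) L + cnt q (2 + j) L ≤ binom (length L) (2 + j)

module _ {A : Set} (_≟_ : DecidableEquality A) where

  open DecMem _≟_ using (_∈?_)

  private
    is : A → A → Bool
    is z v = does (v ≟ z)

  -- A predicate constant along the edges inside `s` extends to `z` by copying its value at
  -- whichever of `l`, `r` lies in `s`. If both do, they are equal or adjacent and their values
  -- agree; if neither does, `z` has no neighbour in `s` and any value works.
  conn-drop : ∀ {E' E : A → A → Set} {z s} l r → z ∉ s →
    (∀ {w} → w ∈ s → E' z w ⊎ E' w z → w ≡ l ⊎ w ≡ r) →
    (∀ {u v} → u ∈ s → v ∈ s → E' u v → E u v) →
    l ≡ r ⊎ E l r → Conn E' (z ∷ s) → Conn E s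
  conn-drop {E'} {E} {z} {s} l r z∉s nbrs old lr C P cl u∈ v∈ =
    ≡-trans (sym (P'-old u∈)) (≡-trans (C P' cl' (there u∈) (there v∈)) (P'-old v∈))
    where
    c : Bool
    c = if does (l ∈? s) then P l else P r
    P' : A → Bool
    P' v = if does (v ≟ z) then c else P v
    P'-new : P' z ≡ c
    P'-new rewrite dec-true (z ≟ z) refl = refl
    P'-old : ∀ {v} → v ∈ s → P' v ≡ P v
    P'-old {v} v∈ rewrite dec-false (v ≟ z) (λ { refl → z∉s v∈ }) = refl
    c-val : ∀ {w} → w ∈ s → w ≡ l ⊎ w ≡ r → c ≡ P w
    c-val w∈ d with l ∈? s
    c-val w∈ (inj₁ refl) | yes _ = refl
    c-val w∈ (inj₂ refl) | yes l∈ = [ cong P , cl l∈ w∈ ]′ lr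
    c-val w∈ (inj₁ refl) | no l∉ = contradiction w∈ l∉
    c-val w∈ (inj₂ refl) | no _ = refl
    nbr : ∀ {w} → w ∈ s → E' z w ⊎ E' w z → P' z ≡ P' w
    nbr w∈ e = ≡-trans P'-new (≡-trans (c-val w∈ (nbrs w∈ e)) (sym (P'-old w∈)))
    cl' : ∀ {u v} → u ∈ z ∷ s → v ∈ z ∷ s → E' u v → P' u ≡ P' v
    cl' (here refl) (here refl) e = refl
    cl' (here refl) (there v∈) e = nbr v∈ (inj₁ e)
    cl' (there u∈) (here refl) e = sym (nbr u∈ (inj₂ e))
    cl' (there u∈) (there v∈) e =
      ≡-trans (P'-old u∈) (≡-trans (cl u∈ v∈ (old u∈ v∈ e)) (sym (P'-old v∈)))

  -- If `s` missed `N`, the indicator of `z` would be constant along edges and still separate `z`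
  -- from `t`.
  conn-touch : ∀ {E : A → A → Set} {z t s} (N : List A) → z ∉ s → t ∈ s →
    (∀ {w} → w ∈ s → E z w ⊎ E w z → w ∈ N) → Conn E (z ∷ s) → Any (_∈ s) N
  conn-touch {E} {z} {t} {s} N z∉s t∈ nbrs C with any? (_∈? s) N
  ... | yes h = h
  ... | no ¬h = contradiction
          (≡-trans (sym (dec-true (z ≟ z) refl))
            (≡-trans (C (is z) cl (here refl) (there t∈)) (dec-false (t ≟ z) (old t∈)))) λ ()
    where
    old : ∀ {v} → v ∈ s → v ≢ z
    old v∈ refl = z∉s v∈
    no-nbr : ∀ {w} → w ∈ s → E z w ⊎ E w z → ⊥
    no-nbr w∈ e = ¬h (lose (nbrs w∈ e) w∈)
    cl : ∀ {u v} → u ∈ z ∷ s → v ∈ z ∷ s → E u v → is z u ≡ is z v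
    cl (here refl) (here refl) e = refl
    cl (here refl) (there v∈) e = ⊥-elim (no-nbr v∈ (inj₁ e))
    cl (there u∈) (here refl) e = ⊥-elim (no-nbr u∈ (inj₂ e))
    cl {u} {v} (there u∈) (there v∈) e =
      ≡-trans (dec-false (u ≟ z) (old u∈)) (sym (dec-false (v ≟ z) (old v∈)))

  -- On two-element sets this selects the edges at `w`, when `N` lists the neighbours of `w`.
  -- Repetitions in `N` are harmless, since only its length enters the bounds.
  star : A → List A → List A → Bool
  star w N s = does (w ∈? s) ∧ does (any? (λ t → (t ∈? s) ×-dec ¬? (t ≟ w)) N)

  -- Union bound over `N`: an entry `t` accounts for at most the single pair of `w` and `t`.
  star-cnt : ∀ w N {L} → Unique L → cnt (star w N) 2 L ≤ length N
  star-cnt w [] {L} U = ≤-reflexive (cnt≡0 _ 2 L (λ s _ _ e → ff (proj₂ (∧-true⁻ (does (w ∈? s)) e))))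
    where ff : false ≡ true → ⊥
          ff ()
  star-cnt w (t ∷ N) {L} U = ≤-trans
    (cnt-split _ one (star w N) 2 L split) (+-mono-≤ (one-cnt (t ≟ w)) (star-cnt w N U))
    where
    one : List A → Bool
    one s = does (w ∈? s) ∧ does ((t ∈? s) ×-dec ¬? (t ≟ w))
    split : Forces (star w (t ∷ N)) (λ s → one s ≡ true ⊎ star w N s ≡ true) 2 L
    split s _ _ e with ∧-true⁻ (does (w ∈? s)) e
    ... | ew , e' with dec-true⁻ (any? (λ t → (t ∈? s) ×-dec ¬? (t ≟ w)) (t ∷ N)) e'
    ...   | here h  = inj₁ (∧-true⁺ ew (dec-true ((t ∈? s) ×-dec ¬? (t ≟ w)) h))
    ...   | there h = inj₂ (∧-true⁺ ew (dec-true (any? (λ t → (t ∈? s) ×-dec ¬? (t ≟ w)) N) h))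
    one⁻ : ∀ s → one s ≡ true → w ∈ s × t ∈ s × t ≢ w
    one⁻ s e = let (a , b) = ∧-true⁻ (does (w ∈? s)) e in
      dec-true⁻ (w ∈? s) a , dec-true⁻ ((t ∈? s) ×-dec ¬? (t ≟ w)) b
    one-cnt : Dec (t ≡ w) → cnt one 2 L ≤ 1
    one-cnt (yes t≡w) = ≤-trans (≤-reflexive (cnt≡0 one 2 L (λ s _ _ e → proj₂ (proj₂ (one⁻ s e)) t≡w))) z≤n
    one-cnt (no t≢w) = cnt-pair _≟_ one w t U (t≢w ∘ sym)
            (λ s _ _ e → let (a , b , _) = one⁻ s e in a , b)

  star-true : ∀ {E : A → A → Set} {w N L s} → Unique L → s ⊆ L → length s ≡ 2 →
    (∀ {t} → t ∈ L → E w t ⊎ E t w → t ∈ N) → w ∈ s → Conn E s → star w N s ≡ true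
  star-true {E} {w} {N} {L} {i ∷ j ∷ []} U s⊆L refl nbrs w∈ C =
    ∧-true⁺ (dec-true (w ∈? _) w∈) (dec-true (any? _ N) (go w∈))
    where
    Us : Unique (i ∷ j ∷ [])
    Us = sublist-unique s⊆L U
    i≢j : i ≢ j
    i≢j refl = Unique[x∷xs]⇒x∉xs Us (here refl)
    other : ∀ {a b} → a ≢ b → b ∈ i ∷ j ∷ [] → (∀ {t} → t ∈ L → E a t ⊎ E t a → t ∈ N) →
      Conn E (a ∷ b ∷ []) → Any (λ t → t ∈ i ∷ j ∷ [] × t ≢ a) N
    other {a} {b} a≢b b∈ nb' C' with conn-touch {z = a} {s = b ∷ []} N
        (λ { (here refl) → a≢b refl }) (here refl) (λ { (here refl) → nb' (⊆-∈ s⊆L b∈) }) C'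
    ... | h = Any.map (λ { (here refl) → b∈ , a≢b ∘ sym }) h
    go : w ∈ i ∷ j ∷ [] → Any (λ t → t ∈ i ∷ j ∷ [] × t ≢ w) N
    go (here refl) = other i≢j (there (here refl)) nbrs C
    go (there (here refl)) = other (i≢j ∘ sym) (here refl) nbrs (conn-perm id (swap i j refl) C)

  -- E' arises from E by subdividing the edge lr with z, or, when l ≡ r, by attaching the leaf z at l.
  record Subdivision (E' E : A → A → Set) (z : A) (L : List A) (l r : A) : Set where
    field
      nbr  : ∀ {w} → w ∈ L → E' z w ⊎ E' w z → w ≡ l ⊎ w ≡ r
      old  : ∀ {u v} → u ∈ L → v ∈ L → E' u v → E u v
      edge : l ≡ r ⊎ E l r

  module _ {E' E : A → A → Set} {z : A} {L : List A} {l r : A}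
           (U : Unique (z ∷ L)) (S : Subdivision E' E z L l r) where

    open Subdivision S

    private
      z∉L : z ∉ L
      z∉L = Unique[x∷xs]⇒x∉xs U

      U' : Unique L
      U' = unique-tail U

    conn-in : ∀ {s} → s ⊆ L → Conn E' (z ∷ s) → Conn E s
    conn-in h = conn-drop l r (z∉L ∘ ⊆-∈ h) (nbr ∘ ⊆-∈ h)
      (λ a b → old (⊆-∈ h a) (⊆-∈ h b)) edge

    conn-out : ∀ {s} → s ⊆ L → Conn E' s → Conn E s
    conn-out h = conn-mono id id (λ a b → old (⊆-∈ h a) (⊆-∈ h b))

    touch : ∀ {s k} → s ⊆ L → length s ≡ suc k → Conn E' (z ∷ s) → l ∈ s ⊎ r ∈ s
    touch {_ ∷ _} h _ C with conn-touch (l ∷ r ∷ []) (z∉L ∘ ⊆-∈ h) (here refl)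
      (λ w e → [ (λ { refl → here refl }) , (λ { refl → there (here refl) }) ]′ (nbr (⊆-∈ h w) e)) C
    ... | here x = inj₁ x
    ... | there (here x) = inj₂ x

    -- Deleting `z` from a connected triple leaves an edge at `l` or at `r`, so there are at most
    -- deg l + deg r triples through `z`. The hypothesis puts this below C(|L|-1, 1), and Pascal's
    -- rule closes the step.
    bound₃-step : ∀ NL NR → (∀ {t} → t ∈ L → E l t ⊎ E t l → t ∈ NL) →
      (∀ {t} → t ∈ L → E r t ⊎ E t r → t ∈ NR) → length NL + length NR ≤ length L ∸ 1 →
      Bound₃ E L → Bound₃ E' (z ∷ L)
    bound₃-step NL NR nl nr d G p I F = begin
      cnt (p ∘ (z ∷_)) 2 L + cnt p 3 L
        ≤⟨ +-mono-≤ (cnt-split _ (star l NL) (star r NR) 2 L split)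
             (G p I (λ s h e t → conn-out h (forces-tail F s h e t))) ⟩
      cnt (star l NL) 2 L + cnt (star r NR) 2 L + binom (length L ∸ 1) 2
        ≤⟨ +-monoˡ-≤ _ (+-mono-≤ (star-cnt l NL U') (star-cnt r NR U')) ⟩
      length NL + length NR + binom (length L ∸ 1) 2 ≤⟨ +-monoˡ-≤ _ d ⟩
      length L ∸ 1 + binom (length L ∸ 1) 2          ≤⟨ pascal (length L) ⟩
      binom (length L) 2 ∎
      where
      open ≤-Reasoning
      pascal : ∀ n → n ∸ 1 + binom (n ∸ 1) 2 ≤ binom n 2
      pascal zero    = z≤n
      pascal (suc n) = +-monoˡ-≤ (binom n 2) (≤-reflexive (sym (binom-1 n)))
      split : Forces (p ∘ (z ∷_)) (λ s → star l NL s ≡ true ⊎ star r NR s ≡ true) 2 L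
      split s h e t with forces-head F s h e t
      ... | C with touch h e C
      ...   | inj₁ l∈ = inj₁ (star-true U' h e nl l∈ (conn-in h C))
      ...   | inj₂ r∈ = inj₂ (star-true U' h e nr r∈ (conn-in h C))

    -- For positive `j` both counts split according to `z`, and `u` survives the deletion because it
    -- differs from `z`; the four parts regroup into two instances of the hypothesis. At `j = 0`
    -- this would involve connected pairs, so `Bound₃` and the trivial count of pairs through `u`
    -- take over.
    leafBound-step : ∀ {u} → u ≢ z → 1 ≤ length L → LeafBound E u L → Bound₃ E' (z ∷ L) → LeafBound E' u (z ∷ L)
    leafBound-step {u} u≢z n≥1 G G3 zero p q Ip Iq Fp Fq = begin
      cnt p 3 (z ∷ L) + cnt q 2 (z ∷ L)
        ≤⟨ +-mono-≤ (G3 p Ip Fp) (cnt-contains _≟_ q 1 u U (λ s h e t → proj₂ (Fq s h e t))) ⟩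
      binom (length L) 2 + binom (length L) 1 ≡⟨ +-comm (binom (length L) 2) _ ⟩
      binom (length L) 1 + binom (length L) 2 ∎
      where open ≤-Reasoning
    leafBound-step {u} u≢z n≥1 G G3 (suc j) p q Ip Iq Fp Fq = begin
      (a + b) + (c + d)  ≡⟨ interchange a b c d ⟩
      (a + c) + (b + d)
        ≤⟨ +-mono-≤
             (G j _ _ (inv-cons z Ip) (inv-cons z Iq)
               (λ s h e t → conn-in h (forces-head Fp s h e t))
               (λ s h e t → let (C , m) = forces-head Fq s h e t in conn-in h C , tail u≢z m))
             (G (suc j) p q Ip Iq
               (λ s h e t → conn-out h (forces-tail Fp s h e t))
               (λ s h e t → let (C , m) = forces-tail Fq s h e t in conn-out h C , m)) ⟩
      binom (length L) (2 + j) + binom (length L) (3 + j) ∎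
      where open ≤-Reasoning
            a = cnt (p ∘ (z ∷_)) (3 + j) L
            b = cnt p (4 + j) L
            c = cnt (q ∘ (z ∷_)) (2 + j) L
            d = cnt q (3 + j) L

  leaf : ∀ {G E : A → A → Set} {v L u} →
    (∀ {w} → w ∈ L → G v w ⊎ G w v → w ≡ u) → (∀ {a b} → a ∈ L → b ∈ L → G a b → E a b) →
    Subdivision G E v L u u
  leaf h o = record { nbr = λ w e → inj₁ (h w e) ; old = o ; edge = inj₁ refl }

  -- Splitting by membership of the leaf `v` yields the two families of `LeafBound`; `touch` shows
  -- that a set of the second family contains `u`.
  leafBound⇒bound : ∀ {G E : A → A → Set} {v L u} → Unique (v ∷ L) → Subdivision G E v L u u →
    LeafBound E u L → Bound G (v ∷ L)
  leafBound⇒bound {v = v} {L} U S g j p I F = ≤-trans (begin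
      cnt (p ∘ (v ∷_)) (2 + j) L + cnt p (3 + j) L ≡⟨ +-comm (cnt (p ∘ (v ∷_)) (2 + j) L) _ ⟩
      cnt p (3 + j) L + cnt (p ∘ (v ∷_)) (2 + j) L
        ≤⟨ g j p _ I (inv-cons v I) (λ s h e t → conn-out U S h (forces-tail F s h e t))
             (λ s h e t → let C = forces-head F s h e t in
               conn-in U S h C , [ id , id ]′ (touch U S h e C)) ⟩
      binom (length L) (2 + j) ∎) (m≤m+n _ _)
    where open ≤-Reasoning

  bound-leaf : ∀ {G : A → A → Set} {v L u} → Unique (v ∷ L) → Subdivision G G v L u u →
    1 ≤ length L → Bound G L → Bound G (v ∷ L)
  bound-leaf {v = v} {L@(_ ∷ L')} {u} U@(_ ∷ U') S _ g j p I F = ≤-trans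
    (+-mono-≤
      (cnt-contains _≟_ _ (suc j) u U'
        (λ s h e t → [ id , id ]′ (touch U S h e (forces-head F s h e t))))
      (g j p I (forces-tail F)))
    (≤-reflexive (sym (+-assoc (binom (length L') (suc j)) _ _)))

-- Small labelled graphs

elem : ℕ → List ℕ → Bool
elem i []      = false
elem i (j ∷ s) = if i ≡ᵇ j then true else elem i s

-- One sweep over the edges inside `s`, adding to `t` an end whose partner is already there. The
-- updated `t` is used at once, so a single sweep may advance along several edges.
spread : List (ℕ × ℕ) → List ℕ → List ℕ → List ℕ
spread []              s t = t
spread ((a , b) ∷ es) s t =
  spread es s (if elem a s ∧ elem b s
               then (if elem a t then (if elem b t then t else b ∷ t)
                     else (if elem b t then a ∷ t else t))
               else t)

iter : ℕ → List (ℕ × ℕ) → List ℕ → List ℕ → List ℕ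
iter zero    es s t = t
iter (suc n) es s t = iter n es s (spread es s t)

splits : List (ℕ × ℕ) → List ℕ → ℕ → List ℕ → Bool
splits es s i t = elem i t ∧ any (λ j → not (elem j t)) s ∧
  all (λ { (a , b) → not (elem a s ∧ elem b s) ∨ not (elem a t xor elem b t) }) es

-- The particular search is irrelevant for soundness: splits verifies the cut it proposes.
cutFound : List (ℕ × ℕ) → List ℕ → Bool
cutFound es []      = false
cutFound es (i ∷ s) = splits es (i ∷ s) i (iter 3 es (i ∷ s) (i ∷ []))

-- An upper approximation of connectedness: a set passes unless a cut of it has been verified.
-- Overcounting is the safe direction for upper bounds.
uncut : List (ℕ × ℕ) → List ℕ → Bool
uncut es s = not (cutFound es s)

-- The theta graph on labels starting at o, with branch vertices o and o + 1.
shape : ℕ → ℕ → ℕ → ℕ → List (ℕ × ℕ)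
shape o a b c = pathEdges o (1 + o) (2 + o) a ++ pathEdges o (1 + o) (2 + o + a) b
  ++ pathEdges o (1 + o) (2 + o + a + b) c

check₃ : ℕ → List (ℕ × ℕ) → Bool
check₃ n es = cnt (uncut es) 3 (upTo n) ≤ᵇ binom (n ∸ 1) 2

-- `LeafBound` for all attachment vertices at once. The range `j < n` covers everything, as
-- `cnt-long` makes the counts vanish beyond it.
checkU : ℕ → List (ℕ × ℕ) → Bool
checkU n es = all (λ u → all (λ j →
  cnt (uncut es) (3 + j) (upTo n) + cnt (λ s → uncut es s ∧ elem u s) (2 + j) (upTo n) ≤ᵇ binom n (2 + j))
  (upTo n)) (upTo n)

checkG : ℕ → List (ℕ × ℕ) → Bool
checkG n es = all (λ j → cnt (uncut es) (3 + j) (upTo n) ≤ᵇ binom (n ∸ 1) (2 + j) + bonus j) (upTo n)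

inRange : ℕ → List (ℕ × ℕ) → Bool
inRange n es = all (λ { (a , b) → (suc a ≤ᵇ n) ∧ (suc b ≤ᵇ n) }) es

Edge : {A : Set} → List (A × A) → A → A → Set
Edge T u v = (u , v) ∈ T ⊎ (v , u) ∈ T

at : {A : Set} → A → List A → ℕ → A
at d []      i       = d
at d (x ∷ L) zero    = x
at d (x ∷ L) (suc i) = at d L i

both : {A B : Set} → (A → B) → A × A → B × B
both f (a , b) = f a , f b

at-∈ : {A : Set} (d : A) (L : List A) → ∀ {i} → i < length L → at d L i ∈ L
at-∈ d (x ∷ L) {zero}  _       = here refl
at-∈ d (x ∷ L) {suc i} (s≤s h) = there (at-∈ d L h)

∈-at : {A : Set} (d : A) {L : List A} {u : A} → u ∈ L → ∃ λ i → i < length L × u ≡ at d L i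
∈-at d (here refl) = 0 , s≤s z≤n , refl
∈-at d (there h) with ∈-at d h
... | i , l , e = suc i , s≤s l , e

elem⁻ : ∀ i s → elem i s ≡ true → i ∈ s
elem⁻ i (j ∷ s) e with i ≡ᵇ j in eq
... | true  = here (≡ᵇ⇒≡ i j (subst Data.Bool.T (sym eq) tt))
... | false = there (elem⁻ i s e)

elem⁺ : ∀ {i s} → i ∈ s → elem i s ≡ true
elem⁺ {i} (here refl) with i ≡ᵇ i in eq
... | true  = refl
... | false = ⊥-elim (subst Data.Bool.T eq (≡⇒≡ᵇ i i refl))
elem⁺ {i} (there {x = j} h) with i ≡ᵇ j
... | true  = refl
... | false = elem⁺ h

any-true⁻ : {A : Set} (p : A → Bool) (s : List A) → any p s ≡ true → ∃ λ a → a ∈ s × p a ≡ true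
any-true⁻ p (a ∷ s) e with p a in eq
... | true  = a , here refl , eq
... | false with any-true⁻ p s e
...   | b , m , h = b , there m , h

any-true⁺ : {A : Set} (p : A → Bool) {s : List A} {a : A} → a ∈ s → p a ≡ true → any p s ≡ true
any-true⁺ p (here refl) e rewrite e = refl
any-true⁺ p (there {x = b} m) e with p b
... | true  = refl
... | false = any-true⁺ p m e

all-true⁻ : {A : Set} (p : A → Bool) (s : List A) → all p s ≡ true → ∀ {a} → a ∈ s → p a ≡ true
all-true⁻ p (a ∷ s) e m with p a in eq
all-true⁻ p (a ∷ s) e (here refl) | true = eq
all-true⁻ p (a ∷ s) e (there m) | true = all-true⁻ p s e m

all-true⁺ : {A : Set} (p : A → Bool) (s : List A) → (∀ {a} → a ∈ s → p a ≡ true) → all p s ≡ true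
all-true⁺ p []      h = refl
all-true⁺ p (a ∷ s) h = ∧-true⁺ (h (here refl)) (all-true⁺ p s (h ∘ there))

xor-false⁻ : ∀ a b → not (a xor b) ≡ true → a ≡ b
xor-false⁻ true  true  e = refl
xor-false⁻ false false e = refl

module _ {A : Set} (_≟_ : DecidableEquality A) where

  pos : A → List A → ℕ
  pos v []      = 0
  pos v (x ∷ L) = if does (v ≟ x) then 0 else suc (pos v L)

  pos-at : ∀ d {L} → Unique L → ∀ {i} → i < length L → pos (at d L i) L ≡ i
  pos-at d {x ∷ L} U {zero} _ rewrite dec-true (x ≟ x) refl = refl
  pos-at d {x ∷ L} (x∉ ∷ U) {suc i} (s≤s h)
    rewrite dec-false (at d L i ≟ x) (λ e → All.lookup x∉ (at-∈ d L h) (sym e))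
    = cong suc (pos-at d U h)

  cnt-long : ∀ (p : List A → Bool) k L → length L < k → cnt p k L ≡ 0
  cnt-long p (suc k) []      h = refl
  cnt-long p (suc k) (x ∷ L) (s≤s h) =
    cong₂ _+_ (cnt-long _ k L h) (cnt-long p (suc k) L (≤-trans h (n≤1+n k)))

  module _ (d : A) {L : List A} (U : Unique L) (es : List (ℕ × ℕ))
           (small : inRange (length L) es ≡ true) where

    private
      F : ℕ → A
      F = at d L
      g : A → ℕ
      g v = pos v L
      F² = both F
      lab : ∀ {a b} → (a , b) ∈ es → g (F a) ≡ a × g (F b) ≡ b
      lab {a} {b} m with ∧-true⁻ (suc a ≤ᵇ length L) (all-true⁻ _ es small m)
      ... | ea , eb = pos-at d U (≤ᵇ⇒≤ _ _ (subst Data.Bool.T (sym ea) tt))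
                    , pos-at d U (≤ᵇ⇒≤ _ _ (subst Data.Bool.T (sym eb) tt))

    -- The cut is pulled back along the labelling: `v` goes to the side of its position in `L`. This
    -- predicate respects all edges inside the set but separates the images of `i` and `j`.
    splits-sound : ∀ s i t → (∀ {j} → j ∈ s → j < length L) → i ∈ s → splits es s i t ≡ true →
      ¬ Conn (Edge (map F² es)) (map F s)
    splits-sound s i t bd i∈ e C with ∧-true⁻ (elem i t) e
    ... | ei , e' with ∧-true⁻ (any (λ j → not (elem j t)) s) e'
    ...   | ej , ee with any-true⁻ (λ j → not (elem j t)) s ej
    ...     | j , j∈ , nj = clash (subst (λ b → not b ≡ true) (≡-trans (sym same) ei) nj)
      where
      clash : not true ≡ true → ⊥
      clash ()
      P : A → Bool
      P v = elem (g v) t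
      gF : ∀ {k} → k ∈ s → g (F k) ≡ k
      gF k∈ = pos-at d U (bd k∈)
      pair : ∀ {a b} → (a , b) ∈ es → F a ∈ map F s → F b ∈ map F s → P (F a) ≡ P (F b)
      pair {a} {b} m fa fb with ∈-map⁻ F fa | ∈-map⁻ F fb
      ... | a' , a'∈ , ea | b' , b'∈ , eb with lab m
      ...   | la , lb with ≡-trans (sym la) (≡-trans (cong g ea) (gF a'∈))
                         | ≡-trans (sym lb) (≡-trans (cong g eb) (gF b'∈))
      ...     | refl | refl rewrite la | lb with all-true⁻ _ es ee m
      ...       | h rewrite elem⁺ a'∈ | elem⁺ b'∈ = xor-false⁻ _ _ h
      cl : ∀ {u v} → u ∈ map F s → v ∈ map F s → Edge (map F² es) u v → P u ≡ P v
      cl u∈ v∈ (inj₁ m) with ∈-map⁻ F² m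
      ... | (a , b) , m' , refl = pair m' u∈ v∈
      cl u∈ v∈ (inj₂ m) with ∈-map⁻ F² m
      ... | (a , b) , m' , refl = sym (pair m' v∈ u∈)
      same : elem i t ≡ elem j t
      same = ≡-trans (cong (λ k → elem k t) (sym (gF i∈)))
        (≡-trans (C P cl (∈-map⁺ F i∈) (∈-map⁺ F j∈)) (cong (λ k → elem k t) (gF j∈)))

    uncut-sound : ∀ s → (∀ {j} → j ∈ s → j < length L) →
      Conn (Edge (map F² es)) (map F s) → uncut es s ≡ true
    uncut-sound s bd C with cutFound es s in eq
    ... | false = refl
    uncut-sound (i ∷ s) bd C | true =
      ⊥-elim (splits-sound (i ∷ s) i (iter 3 es (i ∷ s) (i ∷ [])) bd (here refl) eq C)

    -- True of every list, but kept as an assumption because it is `refl` for the lists of known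
    -- length that are checked.
    module _ (whole : map F (upTo (length L)) ≡ L) where

      forces-uncut : ∀ {p : List A → Bool} {Q : List A → Set} k →
        (∀ {s} → Q s → Conn (Edge (map F² es)) s) → Forces p Q k L →
        Forces (p ∘ map F) (λ s → uncut es s ≡ true × Q (map F s)) k (upTo (length L))
      forces-uncut {p} {Q} k imp Fp s h e t = uncut-sound s (λ m → ∈-upTo⁻ (⊆-∈ h m)) (imp q) , q
        where
        q : Q (map F s)
        q = Fp (map F s) (subst (map F s ⊆_) whole (Subₚ.map⁺ F h)) (≡-trans (length-map F s) e) t

      cnt-label : ∀ (q : List ℕ → Bool) (p' : List A → Bool) k →
        Forces (p' ∘ map F) (λ s → q s ≡ true) k (upTo (length L)) →
        cnt p' k L ≤ cnt q k (upTo (length L))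
      cnt-label q p' k h = ≤-trans
        (≤-reflexive (≡-trans (cong (cnt p' k) (sym whole)) (cnt-map F p' k _)))
        (cnt-mono _ q k _ h)

      ≤-check : ∀ {m n} → (m ≤ᵇ n) ≡ true → m ≤ n
      ≤-check e = ≤ᵇ⇒≤ _ _ (subst Data.Bool.T (sym e) tt)

      bound₃-check : check₃ (length L) es ≡ true → Bound₃ (Edge (map F² es)) L
      bound₃-check e p I Fp = ≤-trans
        (cnt-label (uncut es) p 3 (λ s h l t → proj₁ (forces-uncut 3 id Fp s h l t))) (≤-check e)

      bound-check : checkG (length L) es ≡ true → Bound (Edge (map F² es)) L
      bound-check e j p I Fp with j <? length L
      ... | yes j<n = ≤-trans
        (cnt-label (uncut es) p (3 + j) (λ s h l t → proj₁ (forces-uncut (3 + j) id Fp s h l t)))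
        (≤-check (all-true⁻ _ (upTo (length L)) e (∈-upTo⁺ j<n)))
      ... | no j≮n = ≤-trans (≤-reflexive (cnt-long p (3 + j) L
                       (s≤s (≤-trans (≮⇒≥ j≮n) (m≤n+m j 2))))) z≤n

      leafBound-check : checkU (length L) es ≡ true → ∀ {u} → u ∈ L → LeafBound (Edge (map F² es)) u L
      leafBound-check e {u} u∈ j p q Ip Iq Fp Fq with ∈-at d u∈ | j <? length L
      ... | _ | no j≮n = ≤-trans (≤-reflexive (cong₂ _+_
              (cnt-long p (3 + j) L (s≤s (≤-trans (≮⇒≥ j≮n) (m≤n+m j 2))))
              (cnt-long q (2 + j) L (s≤s (≤-trans (≮⇒≥ j≮n) (m≤n+m j 1)))))) z≤n
      ... | i , i<n , refl | yes j<n = ≤-trans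
        (+-mono-≤
          (cnt-label (uncut es) p (3 + j) (λ s h l t → proj₁ (forces-uncut (3 + j) id Fp s h l t)))
          (cnt-label (λ s → uncut es s ∧ elem i s) q (2 + j) forced))
        (≤-check (all-true⁻ _ (upTo (length L))
          (all-true⁻ _ (upTo (length L)) e (∈-upTo⁺ i<n)) (∈-upTo⁺ j<n)))
        where
        forced : Forces (q ∘ map F) (λ s → uncut es s ∧ elem i s ≡ true) (2 + j) (upTo (length L))
        forced s h l t with forces-uncut (2 + j) proj₁ Fq s h l t
        ... | a , (_ , m) with ∈-map⁻ F m
        ...   | k , k∈ , ek = ∧-true⁺ a (elem⁺ (subst (_∈ s)
                  (≡-trans (sym (pos-at d U (∈-upTo⁻ (⊆-∈ h k∈))))
                    (≡-trans (cong g (sym ek)) (pos-at d U i<n))) k∈))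

-- Theta graphs

unique-perm : {A : Set} {L M : List A} → L ↭ M → Unique L → Unique M
unique-perm {A} r = Permₛ.Unique-resp-↭ (setoid A) (↭⇒↭ₛ r)

sublist-perm : {A : Set} {s L M : List A} → L ↭ M → s ⊆ L → ∃ λ t → t ⊆ M × s ↭ t
sublist-perm {s = s} refl h = s , h , refl
sublist-perm (prep x r) (.x ∷ʳ h) with sublist-perm r h
... | t , h' , r' = t , x ∷ʳ h' , r'
sublist-perm (prep x r) (refl ∷ h) with sublist-perm r h
... | t , h' , r' = x ∷ t , refl ∷ h' , prep x r'
sublist-perm (swap x y r) (.x ∷ʳ .y ∷ʳ h) with sublist-perm r h
... | t , h' , r' = t , y ∷ʳ x ∷ʳ h' , r'
sublist-perm (swap x y r) (.x ∷ʳ refl ∷ h) with sublist-perm r h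
... | t , h' , r' = y ∷ t , refl ∷ x ∷ʳ h' , prep y r'
sublist-perm (swap x y r) (refl ∷ .y ∷ʳ h) with sublist-perm r h
... | t , h' , r' = x ∷ t , y ∷ʳ refl ∷ h' , prep x r'
sublist-perm (swap x y r) (refl ∷ refl ∷ h) with sublist-perm r h
... | t , h' , r' = y ∷ x ∷ t , refl ∷ refl ∷ h' , swap x y r'
sublist-perm (trans r r₁) h with sublist-perm r h
... | t , h' , q with sublist-perm r₁ h'
...   | t' , h'' , q' = t' , h'' , trans q q'

pathPairs : {A : Set} → A → List A → A → List (A × A)
pathPairs x []       y = (x , y) ∷ []
pathPairs x (p ∷ ps) y = (x , p) ∷ pathPairs p ps y

pairsθ : {A : Set} → A → A → List A → List A → List A → List (A × A)
pairsθ x y ps qs rs = pathPairs x ps y ++ pathPairs x qs y ++ pathPairs x rs y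

vertsθ : {A : Set} → A → A → List A → List A → List A → List A
vertsθ x y ps qs rs = x ∷ y ∷ ps ++ qs ++ rs

-- The two bounds travel together because `leafBound-step` needs the triple bound of the subdivided
-- graph; `u` is the vertex where a leaf is to hang.
Boundθ : {A : Set} → A → A → A → List A → List A → List A → Set
Boundθ u x y ps qs rs = Bound₃ E V × LeafBound E u V
  where E = Edge (pairsθ x y ps qs rs)
        V = vertsθ x y ps qs rs

module _ {A : Set} where

  edge-mono : ∀ {T T' : List (A × A)} → (∀ {e} → e ∈ T → e ∈ T') → ∀ {u v} → Edge T u v → Edge T' u v
  edge-mono h (inj₁ m) = inj₁ (h m)
  edge-mono h (inj₂ m) = inj₂ (h m)

  forces-perm : ∀ {p : List A → Bool} {P Q : List A → Set} {k L M} → Inv p → L ↭ M →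
    (∀ {s t} → s ↭ t → P s → Q t) → Forces p P k M → Forces p Q k L
  forces-perm I r pq F s h e t with sublist-perm r h
  ... | s' , h' , r' =
    pq (↭-sym r') (F s' h' (≡-trans (↭-length (↭-sym r')) e) (≡-trans (I (↭-sym r')) t))

  bound₃-perm : ∀ {E E' : A → A → Set} {L M} → L ↭ M → (∀ {u v} → E' u v → E u v) →
    Bound₃ E L → Bound₃ E' M
  bound₃-perm {L = L} {M} r h g p I F = begin
    cnt p 3 M  ≡⟨ cnt-perm 3 I r ⟨
    cnt p 3 L  ≤⟨ g p I (forces-perm I r (conn-perm h) F) ⟩
    binom (length L ∸ 1) 2 ≡⟨ cong (λ n → binom (n ∸ 1) 2) (↭-length r) ⟩
    binom (length M ∸ 1) 2 ∎
    where open ≤-Reasoning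

  leafBound-perm : ∀ {E E' : A → A → Set} {u L M} → L ↭ M → (∀ {u v} → E' u v → E u v) →
    LeafBound E u L → LeafBound E' u M
  leafBound-perm {L = L} {M} r h g j p q Ip Iq Fp Fq = begin
    cnt p (3 + j) M + cnt q (2 + j) M
      ≡⟨ cong₂ _+_ (cnt-perm (3 + j) Ip r) (cnt-perm (2 + j) Iq r) ⟨
    cnt p (3 + j) L + cnt q (2 + j) L
      ≤⟨ g j p q Ip Iq (forces-perm Ip r (conn-perm h) Fp)
           (forces-perm Iq r (λ r' (C , m) → conn-perm h r' C , ∈-resp-↭ r' m) Fq) ⟩
    binom (length L) (2 + j) ≡⟨ cong (λ n → binom n (2 + j)) (↭-length r) ⟩
    binom (length M) (2 + j) ∎
    where open ≤-Reasoning

  swap12 : ∀ x y (ps qs rs : List A) → vertsθ x y ps qs rs ↭ vertsθ x y qs ps rs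
  swap12 x y ps qs rs = prep x (prep y (shifts ps qs))

  swap23 : ∀ x y (ps qs rs : List A) → vertsθ x y ps qs rs ↭ vertsθ x y ps rs qs
  swap23 x y ps qs rs = prep x (prep y (++⁺ (refl {xs = ps}) (++-comm qs rs)))

  -- With `boundθ-swap23` this brings any of the three paths to the front, the only place where
  -- `subdivide` acts.
  boundθ-swap12 : ∀ {u} x y (ps qs rs : List A) → Boundθ u x y ps qs rs → Boundθ u x y qs ps rs
  boundθ-swap12 x y ps qs rs (g , h) =
    bound₃-perm r m g , leafBound-perm r m h
    where
    r = swap12 x y ps qs rs
    m : ∀ {u v} → Edge (pairsθ x y qs ps rs) u v → Edge (pairsθ x y ps qs rs) u v
    m = edge-mono (∈-resp-↭ (shifts (pathPairs x qs y) (pathPairs x ps y)))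

  boundθ-swap23 : ∀ {u} x y (ps qs rs : List A) → Boundθ u x y ps qs rs → Boundθ u x y ps rs qs
  boundθ-swap23 x y ps qs rs (g , h) =
    bound₃-perm r m g , leafBound-perm r m h
    where
    r = swap23 x y ps qs rs
    m : ∀ {u v} → Edge (pairsθ x y ps rs qs) u v → Edge (pairsθ x y ps qs rs) u v
    m = edge-mono (∈-resp-↭ (++⁺ (refl {xs = pathPairs x ps y})
          (++-comm (pathPairs x rs y) (pathPairs x qs y))))

  pathPairs-∈ : ∀ x ps y {a b : A} → (a , b) ∈ pathPairs x ps y →
    (a ≡ x ⊎ a ∈ ps) × (b ≡ y ⊎ b ∈ ps)
  pathPairs-∈ x []       y (here refl) = inj₁ refl , inj₁ refl
  pathPairs-∈ x (p ∷ ps) y (here refl) = inj₁ refl , inj₂ (here refl)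
  pathPairs-∈ x (p ∷ ps) y (there m) with pathPairs-∈ p ps y m
  ... | a , b = inj₂ ([ here , there ]′ a) , [ inj₁ , inj₂ ∘ there ]′ b

  pairsθ-∈ : ∀ x y ps qs rs {a b : A} → (a , b) ∈ pairsθ x y ps qs rs →
    a ∈ vertsθ x y ps qs rs × b ∈ vertsθ x y ps qs rs
  pairsθ-∈ x y ps qs rs {a} {b} m =
    [ lift ∈-++⁺ˡ ∘ pathPairs-∈ x ps y
    , [ lift (∈-++⁺ʳ ps ∘ ∈-++⁺ˡ) ∘ pathPairs-∈ x qs y
      , lift (∈-++⁺ʳ ps ∘ ∈-++⁺ʳ qs) ∘ pathPairs-∈ x rs y
      ]′ ∘ ∈-++⁻ (pathPairs x qs y)
    ]′ (∈-++⁻ (pathPairs x ps y) m)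
    where
    lift : ∀ {L : List A} → (∀ {c} → c ∈ L → c ∈ ps ++ qs ++ rs) →
      (a ≡ x ⊎ a ∈ L) × (b ≡ y ⊎ b ∈ L) → a ∈ vertsθ x y ps qs rs × b ∈ vertsθ x y ps qs rs
    lift i (a , b) = [ here , there ∘ there ∘ i ]′ a , [ there ∘ here , there ∘ there ∘ i ]′ b

-- Degrees in theta graphs and subdivision of their edges

module _ {A : Set} (_≟_ : DecidableEquality A) where

  δ : A → A → ℕ
  δ a w = bit (does (a ≟ w))

  occ : A → List A → ℕ
  occ w []      = 0
  occ w (a ∷ L) = δ a w + occ w L

  -- Neighbours with multiplicity, so that the length is additive over concatenated edge lists and
  -- serves as a degree.
  nbrs : List (A × A) → A → List A
  nbrs []            w = []
  nbrs ((a , b) ∷ T) w = (if does (a ≟ w) then b ∷ [] else []) ++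
                       (if does (b ≟ w) then a ∷ [] else []) ++ nbrs T w

  nbrs-∈ : ∀ {T w t} → Edge T w t ⊎ Edge T t w → t ∈ nbrs T w
  nbrs-∈ {T} {w} {t} e = go T ([ id , [ inj₂ , inj₁ ]′ ]′ e)
    where
    go : ∀ T → Edge T w t → t ∈ nbrs T w
    go ((a , b) ∷ T) (inj₁ (here refl)) rewrite dec-true (w ≟ w) refl = here refl
    go ((a , b) ∷ T) (inj₂ (here refl)) rewrite dec-true (w ≟ w) refl =
      ∈-++⁺ʳ (if does (t ≟ w) then w ∷ [] else []) (here refl)
    go ((a , b) ∷ T) (inj₁ (there m)) = ∈-++⁺ʳ (if does (a ≟ w) then b ∷ [] else [])
      (∈-++⁺ʳ (if does (b ≟ w) then a ∷ [] else []) (go T (inj₁ m)))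
    go ((a , b) ∷ T) (inj₂ (there m)) = ∈-++⁺ʳ (if does (a ≟ w) then b ∷ [] else [])
      (∈-++⁺ʳ (if does (b ≟ w) then a ∷ [] else []) (go T (inj₂ m)))

  nbrs-length : ∀ a b T w → length (nbrs ((a , b) ∷ T) w) ≡ δ a w + (δ b w + length (nbrs T w))
  nbrs-length a b T w with does (a ≟ w) | does (b ≟ w)
  ... | true  | true  = refl
  ... | true  | false = refl
  ... | false | true  = refl
  ... | false | false = refl

  nbrs-length-++ : ∀ T T' w → length (nbrs (T ++ T') w) ≡ length (nbrs T w) + length (nbrs T' w)
  nbrs-length-++ []            T' w = refl
  nbrs-length-++ ((a , b) ∷ T) T' w = begin
    length (nbrs (((a , b) ∷ T) ++ T') w)  ≡⟨ nbrs-length a b (T ++ T') w ⟩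
    δ a w + (δ b w + length (nbrs (T ++ T') w))
      ≡⟨ cong (λ n → δ a w + (δ b w + n)) (nbrs-length-++ T T' w) ⟩
    δ a w + (δ b w + (length (nbrs T w) + length (nbrs T' w)))
      ≡⟨ solve 4 (λ a b c d → a :+ (b :+ (c :+ d)) := (a :+ (b :+ c)) :+ d) refl
           (δ a w) (δ b w) (length (nbrs T w)) (length (nbrs T' w)) ⟩
    (δ a w + (δ b w + length (nbrs T w))) + length (nbrs T' w)
      ≡⟨ cong (_+ length (nbrs T' w)) (nbrs-length a b T w) ⟨
    length (nbrs ((a , b) ∷ T) w) + length (nbrs T' w) ∎
    where open ≡-Reasoning

  nbrs-path : ∀ x ps y w → length (nbrs (pathPairs x ps y) w) ≡ δ x w + δ y w + 2 * occ w ps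
  nbrs-path x [] y w = ≡-trans (nbrs-length x y [] w)
    (solve 2 (λ a b → a :+ (b :+ lit 0) := a :+ b :+ lit 0) refl (δ x w) (δ y w))
  nbrs-path x (p ∷ ps) y w = begin
    length (nbrs (pathPairs x (p ∷ ps) y) w)            ≡⟨ nbrs-length x p (pathPairs p ps y) w ⟩
    δ x w + (δ p w + length (nbrs (pathPairs p ps y) w)) ≡⟨ cong (λ n → δ x w + (δ p w + n)) (nbrs-path p ps y w) ⟩
    δ x w + (δ p w + (δ p w + δ y w + 2 * occ w ps))
      ≡⟨ solve 4 (λ a b c d → a :+ (b :+ (b :+ c :+ lit 2 :* d)) := a :+ c :+ lit 2 :* (b :+ d)) refl
           (δ x w) (δ p w) (δ y w) (occ w ps) ⟩
    δ x w + δ y w + 2 * (δ p w + occ w ps) ∎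
    where open ≡-Reasoning

  occ-++ : ∀ w L M → occ w (L ++ M) ≡ occ w L + occ w M
  occ-++ w []      M = refl
  occ-++ w (a ∷ L) M = ≡-trans (cong (δ a w +_) (occ-++ w L M)) (sym (+-assoc (δ a w) _ _))

  -- An interior vertex lies on two consecutive pairs of its path and the ends lie on one pair of
  -- each path. For distinct vertices this gives degree 3 at `x` and `y` and degree 2 elsewhere.
  nbrs-θ : ∀ x y ps qs rs w → length (nbrs (pairsθ x y ps qs rs) w) ≡
    3 * (δ x w + δ y w) + 2 * occ w (ps ++ qs ++ rs)
  nbrs-θ x y ps qs rs w
    rewrite nbrs-length-++ (pathPairs x ps y) (pathPairs x qs y ++ pathPairs x rs y) w
          | nbrs-length-++ (pathPairs x qs y) (pathPairs x rs y) w
          | nbrs-path x ps y w | nbrs-path x qs y w | nbrs-path x rs y w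
          | occ-++ w ps (qs ++ rs) | occ-++ w qs rs =
    solve 5 (λ x y a b c → x :+ y :+ lit 2 :* a :+ (x :+ y :+ lit 2 :* b :+ (x :+ y :+ lit 2 :* c))
               := lit 3 :* (x :+ y) :+ lit 2 :* (a :+ (b :+ c))) refl
      (δ x w) (δ y w) (occ w ps) (occ w qs) (occ w rs)

  occ-∉ : ∀ {w L} → w ∉ L → occ w L ≡ 0
  occ-∉ {w} {[]}    h = refl
  occ-∉ {w} {a ∷ L} h rewrite dec-false (a ≟ w) (λ { refl → h (here refl) }) = occ-∉ (h ∘ there)

  occ≤1 : ∀ {w L} → Unique L → occ w L ≤ 1
  occ≤1 {w} {[]} U = z≤n
  occ≤1 {w} {a ∷ L} U with a ≟ w
  ... | yes refl rewrite occ-∉ (Unique[x∷xs]⇒x∉xs U) = ≤-refl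
  ... | no _     = occ≤1 (unique-tail U)

  nbrs≤2 : ∀ x y ps qs rs {w} → Unique (vertsθ x y ps qs rs) → w ≢ x → w ≢ y →
    length (nbrs (pairsθ x y ps qs rs) w) ≤ 2
  nbrs≤2 x y ps qs rs {w} U w≢x w≢y
    rewrite nbrs-θ x y ps qs rs w
          | dec-false (x ≟ w) (w≢x ∘ sym) | dec-false (y ≟ w) (w≢y ∘ sym)
    = *-monoʳ-≤ 2 (occ≤1 (unique-tail (unique-tail U)))

  nbrs≤3 : ∀ x y ps qs rs {w} → Unique (vertsθ x y ps qs rs) →
    length (nbrs (pairsθ x y ps qs rs) w) ≤ 3
  nbrs≤3 x y ps qs rs {w} U with x ≟ w | y ≟ w
  ... | no a | no b = ≤-trans (nbrs≤2 x y ps qs rs U (a ∘ sym) (b ∘ sym)) (n≤1+n 2)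
  ... | yes refl | _ rewrite nbrs-θ x y ps qs rs w | dec-true (x ≟ x) refl
        | dec-false (y ≟ x) (λ { refl → Unique[x∷xs]⇒x∉xs U (here refl) })
        | occ-∉ (Unique[x∷xs]⇒x∉xs U ∘ there) = ≤-refl
  ... | no a | yes refl rewrite nbrs-θ x y ps qs rs w | dec-true (y ≟ y) refl
        | dec-false (x ≟ y) a
        | occ-∉ (Unique[x∷xs]⇒x∉xs (unique-tail U)) = ≤-refl

  -- The edge lr of T becomes the path l z r of T'.
  record Refines (T' T : List (A × A)) (z l r : A) : Set where
    field
      new : (l , r) ∈ T
      tri : ∀ {a b} → (a , b) ∈ T' → (a ≡ l × b ≡ z) ⊎ (a ≡ z × b ≡ r) ⊎ (a , b) ∈ T

  refines⇒subdivision : ∀ {T' T z l r L} → z ∉ L → (∀ {a b} → (a , b) ∈ T → a ∈ L × b ∈ L) →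
    Refines T' T z l r → Subdivision _≟_ (Edge T') (Edge T) z L l r
  refines⇒subdivision {T'} {T} {z} {l} {r} {L} z∉ in-L R = record
    { nbr = λ w e → nbr w ([ id , [ inj₂ , inj₁ ]′ ]′ e)
    ; old = λ { u v (inj₁ m) → inj₁ (old u v m) ; u v (inj₂ m) → inj₂ (old v u m) }
    ; edge = inj₂ (inj₁ (Refines.new R))
    }
    where
    tri = Refines.tri R
    nbr : ∀ {w} → w ∈ L → Edge T' z w → w ≡ l ⊎ w ≡ r
    nbr w (inj₁ m) with tri m
    ... | inj₁ (_ , refl) = ⊥-elim (z∉ w)
    ... | inj₂ (inj₁ (_ , e)) = inj₂ e
    ... | inj₂ (inj₂ h) = ⊥-elim (z∉ (proj₁ (in-L h)))
    nbr w (inj₂ m) with tri m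
    ... | inj₁ (e , _) = inj₁ e
    ... | inj₂ (inj₁ (refl , _)) = ⊥-elim (z∉ w)
    ... | inj₂ (inj₂ h) = ⊥-elim (z∉ (proj₂ (in-L h)))
    old : ∀ {u v} → u ∈ L → v ∈ L → (u , v) ∈ T' → (u , v) ∈ T
    old u v m with tri m
    ... | inj₁ (_ , refl) = ⊥-elim (z∉ v)
    ... | inj₂ (inj₁ (refl , _)) = ⊥-elim (z∉ u)
    ... | inj₂ (inj₂ h) = h

  -- The constants 6 and 5 are matched to the degree condition of `bound₃-step`: a degree sum of at
  -- most 5 is at most |V| - 1 once |V| is at least 6.
  grow-θ : ∀ {u T' z l r} x y (ps qs rs : List A) → let V = vertsθ x y ps qs rs ; T = pairsθ x y ps qs rs in
    Unique (z ∷ V) → u ≢ z → 6 ≤ length V → Refines T' T z l r →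
    length (nbrs T l) + length (nbrs T r) ≤ 5 → Boundθ u x y ps qs rs →
    Bound₃ (Edge T') (z ∷ V) × LeafBound (Edge T') u (z ∷ V)
  grow-θ {u} {T'} {z} {l} {r} x y ps qs rs U u≢z six R d (g3 , gU) =
    g3' , leafBound-step _≟_ U S u≢z (s≤s z≤n) gU g3'
    where
    S = refines⇒subdivision (Unique[x∷xs]⇒x∉xs U) (pairsθ-∈ x y ps qs rs) R
    T = pairsθ x y ps qs rs
    g3' = bound₃-step _≟_ U S (nbrs T l) (nbrs T r) (λ _ → nbrs-∈ {T}) (λ _ → nbrs-∈ {T})
            (≤-trans d (∸-monoˡ-≤ 1 six)) g3

  -- Of two interior vertices on one path at least one differs from `u` and can be contracted: `p₁`,
  -- or `p₂` if `u` is `p₁`. The survivor is interior and is an end of the edge being subdivided, so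
  -- the degree sum there is at most 2 + 3.
  subdivide : ∀ {u} x y p₁ p₂ (ps qs rs : List A) → let V = vertsθ x y (p₁ ∷ p₂ ∷ ps) qs rs in
    Unique V → u ∈ V → 7 ≤ length V →
    (∀ p → Unique (vertsθ x y (p ∷ ps) qs rs) → u ∈ vertsθ x y (p ∷ ps) qs rs →
      Boundθ u x y (p ∷ ps) qs rs) →
    Boundθ u x y (p₁ ∷ p₂ ∷ ps) qs rs
  subdivide {u} x y p₁ p₂ ps qs rs U u∈ (s≤s seven) IH with u ≟ p₁
  ... | no u≢p = bound₃-perm (↭-sym r) id (proj₁ g) , leafBound-perm (↭-sym r) id (proj₂ g)
    where
    r : vertsθ x y (p₁ ∷ p₂ ∷ ps) qs rs ↭ p₁ ∷ vertsθ x y (p₂ ∷ ps) qs rs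
    r = shift p₁ (x ∷ y ∷ []) _
    U' = unique-perm r U
    U'' = unique-tail U'
    R : Refines (pairsθ x y (p₁ ∷ p₂ ∷ ps) qs rs) (pairsθ x y (p₂ ∷ ps) qs rs) p₁ x p₂
    R = record
      { new = here refl
      ; tri = λ { (here refl) → inj₁ (refl , refl)
                ; (there (here refl)) → inj₂ (inj₁ (refl , refl))
                ; (there (there m)) → inj₂ (inj₂ (there m)) } }
    g = grow-θ x y (p₂ ∷ ps) qs rs U' u≢p seven R
          (+-mono-≤ (nbrs≤3 x y (p₂ ∷ ps) qs rs U'')
                    (nbrs≤2 x y (p₂ ∷ ps) qs rs U''
                      (λ { refl → Unique[x∷xs]⇒x∉xs U'' (there (here refl)) })
                      (λ { refl → Unique[x∷xs]⇒x∉xs (unique-tail U'') (here refl) })))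
          (IH p₂ U'' (tail u≢p (∈-resp-↭ r u∈)))
  ... | yes refl = bound₃-perm (↭-sym r) id (proj₁ g) , leafBound-perm (↭-sym r) id (proj₂ g)
    where
    r : vertsθ x y (p₁ ∷ p₂ ∷ ps) qs rs ↭ p₂ ∷ vertsθ x y (p₁ ∷ ps) qs rs
    r = shift p₂ (x ∷ y ∷ p₁ ∷ []) _
    U' = unique-perm r U
    U'' = unique-tail U'
    u≢p : p₁ ≢ p₂
    u≢p refl = Unique[x∷xs]⇒x∉xs U' (there (there (here refl)))
    -- Contracting `p₂` joins `p₁` to the successor of `p₂`, which is `y` if the path ends there;
    -- the case split lets `pathPairs` compute.
    next : ∀ ps → ∃ (Refines (pairsθ x y (p₁ ∷ p₂ ∷ ps) qs rs) (pairsθ x y (p₁ ∷ ps) qs rs) p₂ p₁)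
    next [] = y , record
      { new = there (here refl)
      ; tri = λ { (here refl) → inj₂ (inj₂ (here refl))
                ; (there (here refl)) → inj₁ (refl , refl)
                ; (there (there (here refl))) → inj₂ (inj₁ (refl , refl))
                ; (there (there (there m))) → inj₂ (inj₂ (there (there m))) } }
    next (p ∷ ps) = p , record
      { new = there (here refl)
      ; tri = λ { (here refl) → inj₂ (inj₂ (here refl))
                ; (there (here refl)) → inj₁ (refl , refl)
                ; (there (there (here refl))) → inj₂ (inj₁ (refl , refl))
                ; (there (there (there m))) → inj₂ (inj₂ (there (there m))) } }
    g = grow-θ x y (p₁ ∷ ps) qs rs U' u≢p seven (proj₂ (next ps))
          (+-mono-≤ (nbrs≤2 x y (p₁ ∷ ps) qs rs U''
                      (λ { refl → Unique[x∷xs]⇒x∉xs U'' (there (here refl)) })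
                      (λ { refl → Unique[x∷xs]⇒x∉xs (unique-tail U'') (here refl) }))
                    (nbrs≤3 x y (p₁ ∷ ps) qs rs U''))
          (IH p₁ U'' (tail u≢p (∈-resp-↭ r u∈)))

-- Small cases by computation and the induction on the order of the theta graph

length-vertsθ : {A : Set} (x y : A) (ps qs rs : List A) →
  length (vertsθ x y ps qs rs) ≡ 2 + (length ps + (length qs + length rs))
length-vertsθ x y ps qs rs
  rewrite length-++ ps {qs ++ rs} | length-++ qs {rs} = refl

-- Label 1 is the first leaf, label 0 the second, and the theta graph occupies the labels from 2 on.
-- The second leaf may hang on the first, which is the case `j = 0`.
checkLeaves : ℕ → List (ℕ × ℕ) → Bool
checkLeaves n es =
  all (λ i → all (λ j → checkG (2 + n) ((1 , 2 + i) ∷ (0 , 1 + j) ∷ es)) (upTo (suc n))) (upTo n)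

checkLeaves-sound : ∀ n es → checkLeaves n es ≡ true → ∀ {i j} → i < n → j < suc n →
  checkG (2 + n) ((1 , 2 + i) ∷ (0 , 1 + j) ∷ es) ≡ true
checkLeaves-sound n es e {i} {j} i< j< =
  all-true⁻ (λ j → checkG (2 + n) ((1 , 2 + i) ∷ (0 , 1 + j) ∷ es)) (upTo (suc n))
    (all-true⁻ (λ i → all (λ j → checkG (2 + n) ((1 , 2 + i) ∷ (0 , 1 + j) ∷ es)) (upTo (suc n)))
      (upTo n) e (∈-upTo⁺ i<)) (∈-upTo⁺ j<)

-- The digits are the numbers of interior vertices. The six checks on six vertices exhaust a + b + c
-- = 4 with b, c ≥ 1, and the three on five vertices exhaust a + b + c = 3.
checkU-013 : checkU 6 (shape 0 0 1 3) ≡ true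
checkU-013 = refl

checkU-022 : checkU 6 (shape 0 0 2 2) ≡ true
checkU-022 = refl

checkU-031 : checkU 6 (shape 0 0 3 1) ≡ true
checkU-031 = refl

checkU-112 : checkU 6 (shape 0 1 1 2) ≡ true
checkU-112 = refl

checkU-121 : checkU 6 (shape 0 1 2 1) ≡ true
checkU-121 = refl

checkU-211 : checkU 6 (shape 0 2 1 1) ≡ true
checkU-211 = refl

checkLeaves-012 : checkLeaves 5 (shape 2 0 1 2) ≡ true
checkLeaves-012 = refl

checkLeaves-021 : checkLeaves 5 (shape 2 0 2 1) ≡ true
checkLeaves-021 = refl

checkLeaves-111 : checkLeaves 5 (shape 2 1 1 1) ≡ true
checkLeaves-111 = refl

module _ {A : Set} (_≟_ : DecidableEquality A) where

  boundθ-check : ∀ d {L : List A} es → Unique L → inRange (length L) es ≡ true →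
    map (at d L) (upTo (length L)) ≡ L → check₃ (length L) es ≡ true →
    checkU (length L) es ≡ true → ∀ {u} → u ∈ L →
    Bound₃ (Edge (map (both (at d L)) es)) L × LeafBound (Edge (map (both (at d L)) es)) u L
  boundθ-check d es U small whole e3 eU u∈ =
    bound₃-check _≟_ d U es small whole e3 , leafBound-check _≟_ d U es small whole eU u∈

  boundθ-6 : ∀ {u x y : A} ps q qs r rs → length ps + (length qs + length rs) ≡ 2 →
    let V = vertsθ x y ps (q ∷ qs) (r ∷ rs) in Unique V → u ∈ V → Boundθ u x y ps (q ∷ qs) (r ∷ rs)
  boundθ-6 {x = x} [] q [] r (_ ∷ _ ∷ []) refl U = boundθ-check x (shape 0 0 1 3) U refl refl refl checkU-013
  boundθ-6 {x = x} [] q (_ ∷ []) r (_ ∷ []) refl U = boundθ-check x (shape 0 0 2 2) U refl refl refl checkU-022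
  boundθ-6 {x = x} [] q (_ ∷ _ ∷ []) r [] refl U = boundθ-check x (shape 0 0 3 1) U refl refl refl checkU-031
  boundθ-6 {x = x} (_ ∷ []) q [] r (_ ∷ []) refl U = boundθ-check x (shape 0 1 1 2) U refl refl refl checkU-112
  boundθ-6 {x = x} (_ ∷ []) q (_ ∷ []) r [] refl U = boundθ-check x (shape 0 1 2 1) U refl refl refl checkU-121
  boundθ-6 {x = x} (_ ∷ _ ∷ []) q [] r [] refl U = boundθ-check x (shape 0 2 1 1) U refl refl refl checkU-211

  -- `k` is the number of vertices beyond six. If it is positive, some path has at least two
  -- interior vertices, so contraction never empties a path.
  boundθ : ∀ k {u x y : A} ps q qs r rs → length ps + (length qs + length rs) ≡ 2 + k →
    let V = vertsθ x y ps (q ∷ qs) (r ∷ rs) in Unique V → u ∈ V → Boundθ u x y ps (q ∷ qs) (r ∷ rs)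
  boundθ zero ps q qs r rs e U u∈ = boundθ-6 ps q qs r rs e U u∈
  boundθ (suc k) {u} {x} {y} ps q qs r rs e U u∈ = go ps qs rs e U u∈
    where
    big : ∀ ps qs rs → length ps + (length qs + length rs) ≡ 3 + k →
      7 ≤ length (vertsθ x y ps (q ∷ qs) (r ∷ rs))
    big ps qs rs e = ≤-trans (s≤s (s≤s (s≤s (s≤s (s≤s (s≤s (s≤s (z≤n {k}))))))))
      (≤-reflexive (≡-trans (cong (4 +_) (sym e)) (≡-trans (cong (2 +_) (sym shuffle))
        (sym (length-vertsθ x y ps (q ∷ qs) (r ∷ rs))))))
      where
      shuffle : length ps + (suc (length qs) + suc (length rs)) ≡ 2 + (length ps + (length qs + length rs))
      shuffle rewrite +-suc (length qs) (length rs)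
        | +-suc (length ps) (suc (length qs + length rs)) | +-suc (length ps) (length qs + length rs) = refl
    go : ∀ ps qs rs → length ps + (length qs + length rs) ≡ 3 + k →
      let V = vertsθ x y ps (q ∷ qs) (r ∷ rs) in Unique V → u ∈ V → Boundθ u x y ps (q ∷ qs) (r ∷ rs)
    go (p₁ ∷ p₂ ∷ ps) qs rs e U u∈ = subdivide _≟_ x y p₁ p₂ ps (q ∷ qs) (r ∷ rs) U u∈ (big (p₁ ∷ p₂ ∷ ps) qs rs e)
      (λ p U' u∈' → boundθ k (p ∷ ps) q qs r rs (suc-injective e) U' u∈')
    go ps (q₂ ∷ qs) rs e U u∈ = boundθ-swap12 x y (q ∷ q₂ ∷ qs) ps (r ∷ rs)
      (subdivide _≟_ x y q q₂ qs ps (r ∷ rs) (unique-perm s U) (∈-resp-↭ s u∈)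
        (≤-trans (big ps (q₂ ∷ qs) rs e) (≤-reflexive (↭-length s)))
        (λ p U' u∈' → let s' = swap12 x y (p ∷ qs) ps (r ∷ rs) in
          boundθ-swap12 x y ps (p ∷ qs) (r ∷ rs)
            (boundθ k ps p qs r rs (suc-injective (≡-trans (sym (+-suc (length ps) _)) e))
              (unique-perm s' U') (∈-resp-↭ s' u∈'))))
      where s = swap12 x y ps (q ∷ q₂ ∷ qs) (r ∷ rs)
    go ps [] (r₂ ∷ rs) e U u∈ =
      boundθ-swap23 x y ps (r ∷ r₂ ∷ rs) (q ∷ [])
        (boundθ-swap12 x y (r ∷ r₂ ∷ rs) ps (q ∷ [])
          (subdivide _≟_ x y r r₂ rs ps (q ∷ []) (unique-perm s U) (∈-resp-↭ s u∈)
            (≤-trans (big ps [] (r₂ ∷ rs) e) (≤-reflexive (↭-length s)))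
            (λ p U' u∈' →
              let s' = trans (swap12 x y (p ∷ rs) ps (q ∷ [])) (swap23 x y ps (p ∷ rs) (q ∷ [])) in
              boundθ-swap12 x y ps (p ∷ rs) (q ∷ [])
                (boundθ-swap23 x y ps (q ∷ []) (p ∷ rs)
                  (boundθ k ps q [] p rs (suc-injective (≡-trans (sym (+-suc (length ps) _)) e))
                    (unique-perm s' U') (∈-resp-↭ s' u∈'))))))
      where s = trans (swap23 x y ps (q ∷ []) (r ∷ r₂ ∷ rs)) (swap12 x y ps (r ∷ r₂ ∷ rs) (q ∷ []))
    go []       [] [] () U u∈
    go (_ ∷ []) [] [] () U u∈

  lt-true : ∀ {m n} → m < n → (suc m ≤ᵇ n) ≡ true
  lt-true {m} {n} h with suc m ≤ᵇ n in eq
  ... | true = refl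
  ... | false = ⊥-elim (subst Data.Bool.T eq (≤⇒≤ᵇ h))

  bound-leaves-at : ∀ {v₁ v₂ : A} d C es i j → let L = v₂ ∷ v₁ ∷ C ; es' = (1 , 2 + i) ∷ (0 , 1 + j) ∷ es in
    i < length C → j < suc (length C) → inRange (2 + length C) es ≡ true →
    checkG (length L) es' ≡ true → map (at d L) (upTo (length L)) ≡ L → Unique L →
    Bound (Edge (map (both (at d L)) es')) L
  bound-leaves-at d C es i j i< j< small e whole U = bound-check _≟_ d U _
    (∧-true⁺ (lt-true (s≤s (s≤s i<))) (∧-true⁺ (lt-true (s≤s j<)) small)) whole e

  bound-leaves : ∀ {v₁ v₂ u₁ u₂ : A} d C es → inRange (2 + length C) es ≡ true →
    checkLeaves (length C) es ≡ true → let L = v₂ ∷ v₁ ∷ C in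
    map (at d L) (upTo (length L)) ≡ L → Unique L → u₁ ∈ C → u₂ ∈ v₁ ∷ C →
    Bound (Edge ((v₁ , u₁) ∷ (v₂ , u₂) ∷ map (both (at d L)) es)) L
  bound-leaves {v₁} {v₂} d C es small e whole U u₁∈ u₂∈ =
    let (i , i< , e₁) = ∈-at d u₁∈
        (j , j< , e₂) = ∈-at d u₂∈
        L = v₂ ∷ v₁ ∷ C
    in subst₂ (λ a b → Bound (Edge ((v₁ , a) ∷ (v₂ , b) ∷ map (both (at d L)) es)) L) (sym e₁) (sym e₂)
         (bound-leaves-at d C es i j i< j< small (checkLeaves-sound (length C) es e i< j<) whole U)

  bound-7 : ∀ {v₁ v₂ u₁ u₂ x y : A} ps q qs r rs → length ps + (length qs + length rs) ≡ 1 →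
    let C = vertsθ x y ps (q ∷ qs) (r ∷ rs) ; T = pairsθ x y ps (q ∷ qs) (r ∷ rs) in
    Unique (v₂ ∷ v₁ ∷ C) → u₁ ∈ C → u₂ ∈ v₁ ∷ C →
    Bound (Edge ((v₁ , u₁) ∷ (v₂ , u₂) ∷ T)) (v₂ ∷ v₁ ∷ C)
  bound-7 {x = x} [] q [] r (_ ∷ []) refl = bound-leaves x _ (shape 2 0 1 2) refl checkLeaves-012 refl
  bound-7 {x = x} [] q (_ ∷ []) r [] refl = bound-leaves x _ (shape 2 0 2 1) refl checkLeaves-021 refl
  bound-7 {x = x} (_ ∷ []) q [] r [] refl = bound-leaves x _ (shape 2 1 1 1) refl checkLeaves-111 refl

-- Graphs grown from a theta graph by leaves

∉⇒unique : {A : Set} {v : A} {L : List A} → v ∉ L → Unique L → Unique (v ∷ L)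
∉⇒unique v∉ U = All.tabulate (λ { m refl → v∉ m }) ∷ U

unique-++ʳ : {A : Set} (L : List A) {M : List A} → Unique (L ++ M) → Unique M
unique-++ʳ []      U = U
unique-++ʳ (x ∷ L) U = unique-++ʳ L (unique-tail U)

unique-++ˡ : {A : Set} (L : List A) {M : List A} → Unique (L ++ M) → Unique L
unique-++ˡ []      U = []
unique-++ˡ (x ∷ L) U = ∉⇒unique (Unique[x∷xs]⇒x∉xs U ∘ ∈-++⁺ˡ) (unique-++ˡ L (unique-tail U))

unique-disjoint : {A : Set} (L : List A) {M : List A} {v : A} → Unique (L ++ M) → v ∈ L → v ∉ M
unique-disjoint (x ∷ L) U (here refl) m = Unique[x∷xs]⇒x∉xs U (∈-++⁺ʳ L m)
unique-disjoint (x ∷ L) U (there h)   m = unique-disjoint L (unique-tail U) h m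

complement : ∀ {n} (C : List (Fin n)) → Unique C → ∃ λ M → C ++ M ↭ allFin n
complement {n} [] U = allFin n , refl
complement {n} (c ∷ C) U with complement C (unique-tail U)
... | M , r with ∈-++⁻ C (∈-resp-↭ (↭-sym r) (∈-allFin c))
...   | inj₁ m = ⊥-elim (Unique[x∷xs]⇒x∉xs U m)
...   | inj₂ m with ∈-∃++ m
...     | M₁ , M₂ , refl = M₁ ++ M₂ ,
            trans (↭-sym (trans (++⁺ˡ C (shift c M₁ M₂)) (shift c C (M₁ ++ M₂)))) r

-- A predicate on vertex lists, so that the number of edges is an instance of `cnt` and inherits its
-- invariance under reordering.
isEdge : ∀ {n} → Adj n → List (Fin n) → Bool
isEdge G (i ∷ j ∷ []) = G i j
isEdge G _            = false

module _ {n : ℕ} (G : Adj n) (sy : ∀ i j → G i j ≡ G j i) (irr : ∀ i → G i i ≡ false) where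

  private
    V = Fin n
    open DecMem (_≟ᶠ_ {n}) using (_∈?_)

  R : V → V → Set
  R u v = G u v ≡ true

  R-sym : ∀ {u v} → R u v → R v u
  R-sym {u} {v} e = ≡-trans (sy v u) e

  edgeᵇ : List V → Bool
  edgeᵇ = isEdge G

  edgeᵇ-long : ∀ s → length s ≢ 2 → edgeᵇ s ≡ false
  edgeᵇ-long []              h = refl
  edgeᵇ-long (_ ∷ [])        h = refl
  edgeᵇ-long (_ ∷ _ ∷ [])    h = ⊥-elim (h refl)
  edgeᵇ-long (_ ∷ _ ∷ _ ∷ _) h = refl

  edgeᵇ-inv : Inv edgeᵇ
  edgeᵇ-inv {s} {t} r with length s Data.Nat.≟ 2
  ... | no h = ≡-trans (edgeᵇ-long s h) (sym (edgeᵇ-long t (h ∘ ≡-trans (↭-length r))))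
  ... | yes h = go r h
    where
    go : ∀ {s t} → s ↭ t → length s ≡ 2 → edgeᵇ s ≡ edgeᵇ t
    go refl h = refl
    go {_ ∷ _ ∷ []} (prep x r) h with ↭-singleton-inv (↭-sym r)
    ... | refl = refl
    go {_ ∷ _ ∷ []} (swap x y r) h with ↭-empty-inv (↭-sym r)
    ... | refl = sy x y
    go (trans r r') h = ≡-trans (go r h) (go r' (≡-trans (sym (↭-length r)) h))

  edges : List V → ℕ
  edges L = cnt edgeᵇ 2 L

  -- Each new vertex is only required to have some neighbour; that it has just one is extracted
  -- later from the edge count.
  data Ext (C : List V) : List V → Set where
    base : Ext C C
    add  : ∀ {v u L} → Ext C L → v ∉ L → u ∈ L → R v u → Ext C (v ∷ L)

  ext-unique : ∀ {C L} → Unique C → Ext C L → Unique L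
  ext-unique U base          = U
  ext-unique U (add E v∉ _ _) = ∉⇒unique v∉ (ext-unique U E)

  -- Every added vertex brings at least one edge, so the excess of edges over vertices never drops.
  -- Against `Tight` this leaves exactly one edge per added vertex.
  ext-edges : ∀ {C L} → suc (length C) ≤ edges C → Ext C L → suc (length L) ≤ edges L
  ext-edges h base             = h
  ext-edges h (add E v∉ u∈ r) = +-mono-≤ (1≤cnt1 (edgeᵇ ∘ (_ ∷_)) u∈ r) (ext-edges h E)

  ext-length : ∀ {C L} → Ext C L → length C ≤ length L
  ext-length base          = ≤-refl
  ext-length (add E _ _ _) = ≤-trans (ext-length E) (n≤1+n _)

  -- Induction on the number `k` of vertices outside `L`. If none of them had a neighbour in `L`,
  -- membership in `L` would be a cut of the connected graph.
  extend : Conn R (allFin n) → ∀ {C x} k L M → length M ≡ k → L ++ M ↭ allFin n → x ∈ L → Ext C L →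
    ∃ λ L' → Ext C L' × L' ↭ allFin n
  extend con zero L [] e r x∈ E = L , E , subst (_↭ allFin n) (++-identityʳ L) r
  extend con {x = x} (suc k) L M@(m ∷ _) e r x∈ E with any? (λ v → any? (λ u → G v u Data.Bool.≟ true) L) M
  ... | yes found with find found
  ...   | v , v∈ , h with find h | ∈-∃++ v∈
  ...     | u , u∈ , Rvu | M₁ , M₂ , eq =
    extend con k (v ∷ L) (M₁ ++ M₂) (suc-injective (≡-trans (sym len) e)) r' (there x∈)
      (add E (λ m → unique-disjoint L (unique-perm (↭-sym r) (allFin⁺ n)) m v∈) u∈ Rvu)
    where
    len : length M ≡ suc (length (M₁ ++ M₂))
    len = ≡-trans (cong length eq) (↭-length (shift v M₁ M₂))
    r' : v ∷ L ++ (M₁ ++ M₂) ↭ allFin n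
    r' = trans (↭-sym (trans (++⁺ˡ L (shift v M₁ M₂)) (shift v L (M₁ ++ M₂))))
               (subst (λ N → L ++ N ↭ allFin n) eq r)
  extend con {x = x} (suc k) L M@(m ∷ _) e r x∈ E | no none =
    contradiction (≡-trans (sym (dec-true (x ∈? L) x∈))
      (≡-trans (con P cl (∈-allFin x) (∈-allFin m)) (dec-false (m ∈? L) m∉))) λ ()
    where
    P : V → Bool
    P v = does (v ∈? L)
    m∉ : m ∉ L
    m∉ h = unique-disjoint L (unique-perm (↭-sym r) (allFin⁺ n)) h (here refl)
    out : ∀ {v} → v ∉ L → v ∈ M
    out {v} h = [ (λ a → ⊥-elim (h a)) , id ]′ (∈-++⁻ L (∈-resp-↭ (↭-sym r) (∈-allFin v)))
    cross : ∀ {u v} → u ∈ L → v ∉ L → R v u → ⊥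
    cross u∈ v∉ h = none (lose (out v∉) (lose u∈ h))
    cl : ∀ {u v} → u ∈ allFin n → v ∈ allFin n → R u v → P u ≡ P v
    cl {u} {v} _ _ h with u ∈? L | v ∈? L
    ... | yes _ | yes _ = refl
    ... | no _  | no _  = refl
    ... | yes a | no b  = ⊥-elim (cross a b (R-sym h))
    ... | no a  | yes b = ⊥-elim (cross b a h)

  spanning : Conn R (allFin n) → ∀ {C x} → Unique C → x ∈ C → ∃ λ L → Ext C L × L ↭ allFin n
  spanning con {C} U x∈ with complement C U
  ... | M , r = extend con (length M) C M refl r x∈ base

  Tight : List V → Set
  Tight L = edges L ≤ suc (length L)

  tight-split : ∀ {a b m} → 1 ≤ a → suc m ≤ b → a + b ≤ suc (suc m) → a ≤ 1 × b ≤ suc m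
  tight-split {suc a} {b} {m} _ h t =
      +-cancelʳ-≤ (suc m) (suc a) 1 (≤-trans (+-monoʳ-≤ (suc a) h) t)
    , ≤-trans (m≤n+m b a) (Data.Nat.s≤s⁻¹ t)

  tight-tail : ∀ {C v u L} → suc (length C) ≤ edges C → Ext C L → u ∈ L → R v u →
    Tight (v ∷ L) → Tight L
  tight-tail h E u∈ r t = proj₂ (tight-split (1≤cnt1 _ u∈ r) (ext-edges h E) t)

  -- A second neighbour would give `v` two edges into `L`, while `L` already has more edges than
  -- vertices; `Tight` excludes this.
  only-nbr : ∀ {C v u L} → suc (length C) ≤ edges C → Ext C L → u ∈ L → R v u → Tight (v ∷ L) →
    ∀ {w} → w ∈ L → R v w ⊎ R w v → w ≡ u
  only-nbr {C} {v} {u} {L} h E u∈ r t {w} w∈ e with w ≟ᶠ u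
  ... | yes w≡u = w≡u
  ... | no w≢u = contradiction
    (≤-trans (2≤cnt1 _ w∈ u∈ w≢u ([ id , R-sym ]′ e) r)
             (proj₁ (tight-split (1≤cnt1 _ u∈ r) (ext-edges h E) t))) λ { (s≤s ()) }

  bound-mono : ∀ {E L} → (∀ {u v} → u ∈ L → v ∈ L → R u v → E u v) → Bound E L → Bound R L
  bound-mono h g j p I F = g j p I (λ s s⊆ l t →
    conn-mono id id (λ a b → h (⊆-∈ s⊆ a) (⊆-∈ s⊆ b)) (F s s⊆ l t))

  ext-bound : ∀ {C L} → suc (length C) ≤ edges C → Unique C → 1 ≤ length C →
    Bound R C → Ext C L → Tight L → Bound R L
  ext-bound h U ne g base t = g
  ext-bound h U ne g (add E v∉ u∈ r) t =
    bound-leaf _≟ᶠ_ (∉⇒unique v∉ (ext-unique U E))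
      (leaf _≟ᶠ_ (only-nbr h E u∈ r t) (λ _ _ e → e)) (≤-trans ne (ext-length E))
      (ext-bound h U ne g E (tight-tail h E u∈ r t))

  -- Every subset may be counted: C(4,3) = 4 = C(3,2) + 1 uses the bonus in full, and C(4,4) =
  -- C(3,3).
  bound-small : ∀ {C} → length C ≡ 4 → Bound R C
  bound-small {C} e j p I F = ≤-trans (cnt≤binom p (3 + j) C)
    (subst (λ m → binom m (3 + j) ≤ binom (m ∸ 1) (2 + j) + bonus j) (sym e) (small j))
    where
    small : ∀ j → binom 4 (3 + j) ≤ binom 3 (2 + j) + bonus j
    small zero          = ≤-refl
    small (suc zero)    = ≤-refl
    small (suc (suc j)) = z≤n

  -- The vertex added first hangs on the theta graph itself and consumes `LeafBound`; all later ones
  -- go through `bound-leaf`.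
  ext-leafBound : ∀ {C L E} → suc (length C) ≤ edges C → Unique C → 1 ≤ length C →
    (∀ {u v} → u ∈ C → v ∈ C → R u v → E u v) → (∀ {u} → u ∈ C → LeafBound E u C) →
    Ext C L → Tight L → length C < length L → Bound R L
  ext-leafBound h U ne sub g base t lt = contradiction lt (<-irrefl refl)
  ext-leafBound h U ne sub g (add base v∉ u∈ r) t lt =
    leafBound⇒bound _≟ᶠ_ (∉⇒unique v∉ U) (leaf _≟ᶠ_ (only-nbr h base u∈ r t) sub) (g u∈)
  ext-leafBound h U ne sub g (add E@(add E' _ _ _) v∉ u∈ r) t lt =
    bound-leaf _≟ᶠ_ (∉⇒unique v∉ (ext-unique U E))
      (leaf _≟ᶠ_ (only-nbr h E u∈ r t) (λ _ _ e → e)) (s≤s z≤n)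
      (ext-leafBound h U ne sub g E (tight-tail h E u∈ r t) (s≤s (ext-length E')))

  -- The first two added vertices are treated as a pair, since five vertices and one leaf do not yet
  -- satisfy the bound in general.
  ext-bound7 : ∀ {C L T} → suc (length C) ≤ edges C → Unique C → length C ≡ 5 →
    (∀ {u v} → u ∈ C → v ∈ C → R u v → Edge T u v) →
    (∀ {v₁ v₂ u₁ u₂} → Unique (v₂ ∷ v₁ ∷ C) → u₁ ∈ C → u₂ ∈ v₁ ∷ C →
      Bound (Edge ((v₁ , u₁) ∷ (v₂ , u₂) ∷ T)) (v₂ ∷ v₁ ∷ C)) →
    Ext C L → Tight L → 7 ≤ length L → Bound R L
  ext-bound7 h U five sub g base t lt = contradiction (subst (7 ≤_) five lt) λ { (s≤s (s≤s (s≤s (s≤s (s≤s ()))))) }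
  ext-bound7 h U five sub g (add base _ _ _) t (s≤s lt) =
    contradiction (subst (6 ≤_) five lt) λ { (s≤s (s≤s (s≤s (s≤s (s≤s ()))))) }
  ext-bound7 {C} {T = T} h U five sub g (add {v₂} {u₂} (add {v₁} {u₁} base v₁∉ u₁∈ r₁) v₂∉ u₂∈ r₂) t lt =
    bound-mono incl (g (∉⇒unique v₂∉ (∉⇒unique v₁∉ U)) u₁∈ u₂∈)
    where
    E₁ : Ext C (v₁ ∷ C)
    E₁ = add base v₁∉ u₁∈ r₁
    nbr₂ : ∀ {w} → w ∈ v₁ ∷ C → R v₂ w ⊎ R w v₂ → w ≡ u₂
    nbr₂ = only-nbr h E₁ u₂∈ r₂ t
    nbr₁ : ∀ {w} → w ∈ C → R v₁ w ⊎ R w v₁ → w ≡ u₁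
    nbr₁ = only-nbr h base u₁∈ r₁ (tight-tail h E₁ u₂∈ r₂ t)
    T' = (v₁ , u₁) ∷ (v₂ , u₂) ∷ T
    loop-free : ∀ {v} → R v v → Edge T' v v
    loop-free {v} e = contradiction (≡-trans (sym e) (irr v)) λ ()
    incl : ∀ {a b} → a ∈ v₂ ∷ v₁ ∷ C → b ∈ v₂ ∷ v₁ ∷ C → R a b → Edge T' a b
    incl (here refl) (here refl) e = loop-free e
    incl (here refl) (there b) e with nbr₂ b (inj₁ e)
    ... | refl = inj₁ (there (here refl))
    incl (there a) (here refl) e with nbr₂ a (inj₂ e)
    ... | refl = inj₂ (there (here refl))
    incl (there (here refl)) (there (here refl)) e = loop-free e
    incl (there (here refl)) (there (there b)) e with nbr₁ b (inj₁ e)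
    ... | refl = inj₁ (here refl)
    incl (there (there a)) (there (here refl)) e with nbr₁ a (inj₂ e)
    ... | refl = inj₂ (here refl)
    incl (there (there a)) (there (there b)) e = [ inj₁ ∘ there ∘ there , inj₂ ∘ there ∘ there ]′ (sub a b e)
  ext-bound7 {L = _ ∷ _ ∷ L''} h U five sub g (add E@(add (add E' _ _ _) _ _ _) v∉ u∈ r) t lt =
    bound-leaf _≟ᶠ_ (∉⇒unique v∉ (ext-unique U E))
      (leaf _≟ᶠ_ (only-nbr h E u∈ r t) (λ _ _ e → e)) (s≤s z≤n)
      (ext-bound7 h U five sub g E (tight-tail h E u∈ r t)
        (s≤s (s≤s (subst (_≤ _) five (ext-length E')))))

  -- Edge count and minimum degree of the embedded theta graph

  Path : V → List V → V → Set
  Path w ps y = ∀ {a b} → (a , b) ∈ pathPairs w ps y → R a b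

  edges-path : ∀ q qs {y M} → y ∈ M → Path q qs y →
    suc (length qs) + edges M ≤ edges (q ∷ qs ++ M)
  edges-path q [] y∈ r = +-monoˡ-≤ _ (1≤cnt1 (edgeᵇ ∘ (q ∷_)) y∈ (r (here refl)))
  edges-path q (q₂ ∷ qs) y∈ r =
    +-mono-≤ {1} (1≤cnt1 (edgeᵇ ∘ (q ∷_)) {L = q₂ ∷ qs ++ _} (here refl) (r (here refl))) (edges-path q₂ qs y∈ (r ∘ there))

  -- An ear adds one more edge than vertices: each interior vertex is charged the edge to its
  -- successor, and the first one also the edge back to `w`.
  edges-ear : ∀ w q qs {y M} → w ∈ M → y ∈ M → w ≢ y → Unique (q ∷ qs ++ M) → Path w (q ∷ qs) y →
    2 + length qs + edges M ≤ edges (q ∷ qs ++ M)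
  edges-ear w q [] w∈ y∈ w≢y U r =
    +-monoˡ-≤ _ (2≤cnt1 (edgeᵇ ∘ (q ∷_)) w∈ y∈ w≢y (R-sym (r (here refl))) (r (there (here refl))))
  edges-ear w q (q₂ ∷ qs) {M = M} w∈ y∈ w≢y U r =
    +-mono-≤ {2} (2≤cnt1 (edgeᵇ ∘ (q ∷_)) {L = q₂ ∷ qs ++ M} (∈-++⁺ʳ (q₂ ∷ qs) w∈) (here refl) w≢q₂
                   (R-sym (r (here refl))) (r (there (here refl))))
      (edges-path q₂ qs y∈ (r ∘ there ∘ there))
    where
    w≢q₂ : w ≢ q₂
    w≢q₂ refl = unique-disjoint (q₂ ∷ qs) (unique-tail U) (here refl) w∈

  twoNbrs : V → Set
  twoNbrs v = ∃ λ a → ∃ λ b → a ≢ b × R v a × R v b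

  next : ∀ p ps {y} → Path p ps y → ∃ λ b → (b ≡ y ⊎ b ∈ ps) × R p b
  next p []      {y} r = y , inj₁ refl , r (here refl)
  next p (q ∷ _) r     = q , inj₂ (here refl) , r (here refl)

  last : ∀ x q qs {y} → Path x (q ∷ qs) y → ∃ λ b → b ∈ q ∷ qs × R b y
  last x q []        r = q , here refl , r (there (here refl))
  last x q (q₂ ∷ qs) r with last q q₂ qs (r ∘ there)
  ... | b , m , h = b , there m , h

  interior : ∀ x ps {y v} → Unique (x ∷ ps) → y ∉ x ∷ ps → Path x ps y → v ∈ ps → twoNbrs v
  interior x (p ∷ ps) {y} U y∉ r (here refl) with next p ps (r ∘ there)
  ... | b , w , h = x , b , x≢b w , R-sym (r (here refl)) , h
    where
    x≢b : b ≡ y ⊎ b ∈ ps → x ≢ b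
    x≢b (inj₁ refl) refl = y∉ (here refl)
    x≢b (inj₂ m)    refl = Unique[x∷xs]⇒x∉xs U (there m)
  interior x (p ∷ ps) U y∉ r (there v∈) =
    interior p ps (unique-tail U) (y∉ ∘ there) (r ∘ there) v∈

  module _ {x y q r : V} {ps qs rs : List V} where

    private
      C : List V
      C = vertsθ x y ps (q ∷ qs) (r ∷ rs)
      I : List V
      I = ps ++ (q ∷ qs) ++ (r ∷ rs)

    module _ (U : Unique C)
             (sup : ∀ {a b} → (a , b) ∈ pairsθ x y ps (q ∷ qs) (r ∷ rs) → R a b) where

      private
        pathP : Path x ps y
        pathP m = sup (∈-++⁺ˡ m)
        pathQ : Path x (q ∷ qs) y
        pathQ m = sup (∈-++⁺ʳ (pathPairs x ps y) (∈-++⁺ˡ m))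
        pathR : Path x (r ∷ rs) y
        pathR m = sup (∈-++⁺ʳ (pathPairs x ps y) (∈-++⁺ʳ (pathPairs x (q ∷ qs) y) m))
        x≢y : x ≢ y
        x≢y refl = Unique[x∷xs]⇒x∉xs U (here refl)

        UI : Unique I
        UI = unique-tail (unique-tail U)
        within : ∀ ts {v} → Unique ts → (∀ {a} → a ∈ ts → a ∈ I) → Path x ts y → v ∈ ts → twoNbrs v
        within ts Ut i = interior x ts (∉⇒unique (Unique[x∷xs]⇒x∉xs U ∘ there ∘ i) Ut)
          (λ { (here e) → x≢y (sym e) ; (there m) → Unique[x∷xs]⇒x∉xs (unique-tail U) (i m) })

      -- Ears are glued onto the pair of `x` and `y`. Without an edge its excess of edges over
      -- vertices is -2 and three ears follow; if `ps` is empty, the edge from `x` to `y` makes it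
      -- -1 and two ears follow. Either way the excess ends at 1.
      edgesθ : suc (length C) ≤ edges C
      edgesθ = ≤-trans (≤-reflexive (cong suc (length-vertsθ x y ps (q ∷ qs) (r ∷ rs))))
        (≤-trans (count ps pathP (unique-perm perm U)) (≤-reflexive (sym (cnt-perm 2 edgeᵇ-inv perm))))
        where
        M₀ M₁ M₂ : List V
        M₀ = x ∷ y ∷ []
        M₁ = r ∷ rs ++ M₀
        M₂ = q ∷ qs ++ M₁
        perm : C ↭ ps ++ M₂
        perm = trans (++-comm M₀ I) (↭-reflexive
          (≡-trans (++-assoc ps ((q ∷ qs) ++ (r ∷ rs)) M₀) (cong (ps ++_) (++-assoc (q ∷ qs) (r ∷ rs) M₀))))
        x∈ : x ∈ M₂
        x∈ = ∈-++⁺ʳ (q ∷ qs) (∈-++⁺ʳ (r ∷ rs) (here refl))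
        y∈ : y ∈ M₂
        y∈ = ∈-++⁺ʳ (q ∷ qs) (∈-++⁺ʳ (r ∷ rs) (there (here refl)))
        count₂ : Unique M₂ → 2 + length qs + (2 + length rs + edges M₀) ≤ edges M₂
        count₂ U₂ = ≤-trans
          (+-monoʳ-≤ (2 + length qs)
            (edges-ear x r rs (here refl) (there (here refl)) x≢y (unique-++ʳ (q ∷ qs) U₂) pathR))
          (edges-ear x q qs (∈-++⁺ʳ (r ∷ rs) (here refl)) (∈-++⁺ʳ (r ∷ rs) (there (here refl))) x≢y U₂ pathQ)
        count : ∀ ps → Path x ps y → Unique (ps ++ M₂) →
          3 + (length ps + (suc (length qs) + suc (length rs))) ≤ edges (ps ++ M₂)
        count [] path U₂ = ≤-trans
          (≤-reflexive (solve 2 (λ a b → lit 3 :+ (lit 1 :+ a :+ (lit 1 :+ b))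
            := lit 2 :+ a :+ (lit 2 :+ b :+ lit 1)) refl (length qs) (length rs)))
          (≤-trans (+-monoʳ-≤ (2 + length qs) (+-monoʳ-≤ (2 + length rs) (xy (path (here refl))))) (count₂ U₂))
          where
          xy : R x y → 1 ≤ edges M₀
          xy h rewrite h = s≤s z≤n
        count (p ∷ ps) path U₃ = ≤-trans
          (≤-reflexive (solve 3 (λ c a b → lit 3 :+ (lit 1 :+ c :+ (lit 1 :+ a :+ (lit 1 :+ b)))
            := lit 2 :+ c :+ (lit 2 :+ a :+ (lit 2 :+ b :+ lit 0))) refl (length ps) (length qs) (length rs)))
          (≤-trans (+-monoʳ-≤ (2 + length ps) (≤-trans
              (+-monoʳ-≤ (2 + length qs) (+-monoʳ-≤ (2 + length rs) z≤n)) (count₂ (unique-++ʳ (p ∷ ps) U₃))))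
            (edges-ear x p ps x∈ y∈ x≢y U₃ path))

      -- This places the given leaf of `G` outside the theta graph, so at least one vertex is added
      -- in `Ext`.
      min-degree : ∀ {v} → v ∈ C → twoNbrs v
      min-degree (here refl) = q , r , q≢r , pathQ (here refl) , pathR (here refl)
        where
        q≢r : q ≢ r
        q≢r refl = unique-disjoint (q ∷ qs) (unique-++ʳ ps (unique-tail (unique-tail U))) (here refl) (here refl)
      min-degree (there (here refl)) with last x q qs pathQ | last x r rs pathR
      ... | a , a∈ , Ra | b , b∈ , Rb = a , b , a≢b , R-sym Ra , R-sym Rb
        where
        a≢b : a ≢ b
        a≢b refl = unique-disjoint (q ∷ qs) (unique-++ʳ ps (unique-tail (unique-tail U))) a∈ b∈
      min-degree (there (there v∈)) with ∈-++⁻ ps v∈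
      ... | inj₁ m = within ps (unique-++ˡ ps UI) ∈-++⁺ˡ pathP m
      ... | inj₂ m with ∈-++⁻ (q ∷ qs) m
      ...   | inj₁ k = within (q ∷ qs) (unique-++ˡ (q ∷ qs) (unique-++ʳ ps UI)) (∈-++⁺ʳ ps ∘ ∈-++⁺ˡ) pathQ k
      ...   | inj₂ k = within (r ∷ rs) (unique-++ʳ (q ∷ qs) (unique-++ʳ ps UI))
                         (∈-++⁺ʳ ps ∘ ∈-++⁺ʳ (q ∷ qs)) pathR k

    theta-bound : Unique C → (∀ {u v} → u ∈ C → v ∈ C → R u v → Edge (pairsθ x y ps (q ∷ qs) (r ∷ rs)) u v) →
      (∀ {a b} → (a , b) ∈ pairsθ x y ps (q ∷ qs) (r ∷ rs) → R a b) →
      Conn R (allFin n) → edges (allFin n) ≤ suc n → (∃ λ v → ¬ twoNbrs v) → 7 ≤ n →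
      Bound R (allFin n)
    theta-bound U sub sup con tight (v₀ , leaf₀) 7≤n = bound
      where
      span = spanning con U (here {x = x} refl)
      L = proj₁ span
      E = proj₁ (proj₂ span)
      perm = proj₂ (proj₂ span)
      lenL : length L ≡ n
      lenL = ≡-trans (↭-length perm) (length-tabulate id)
      tightL : Tight L
      tightL = ≤-trans (≤-reflexive (cnt-perm 2 edgeᵇ-inv perm)) (≤-trans tight (≤-reflexive (cong suc (sym lenL))))
      h = edgesθ U sup
      strict : ∀ {L} → Ext C L → v₀ ∈ L → length C < length L
      strict base m = ⊥-elim (leaf₀ (min-degree U sup m))
      strict (add E _ _ _) m = s≤s (ext-length E)
      lenC = length-vertsθ x y ps (q ∷ qs) (r ∷ rs)
      shuffle : length ps + (suc (length qs) + suc (length rs)) ≡ 2 + (length ps + (length qs + length rs))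
      shuffle = solve 3 (λ a b c → a :+ (lit 1 :+ b :+ (lit 1 :+ c)) := lit 2 :+ (a :+ (b :+ c))) refl
        (length ps) (length qs) (length rs)
      -- The theta graph has 4 + `m` vertices, so the clauses are orders four, five, and at least
      -- six.
      goodL : ∀ m → length ps + (length qs + length rs) ≡ m → Bound R L
      goodL zero e = ext-bound h U (s≤s z≤n)
        (bound-small (≡-trans lenC (cong (2 +_) (≡-trans shuffle (cong (2 +_) e))))) E tightL
      goodL (suc zero) e = ext-bound7 h U (≡-trans lenC (cong (2 +_) (≡-trans shuffle (cong (2 +_) e)))) sub
        (bound-7 _≟ᶠ_ ps q qs r rs e) E tightL (subst (7 ≤_) (sym lenL) 7≤n)
      goodL (suc (suc k)) e = ext-leafBound h U (s≤s z≤n) sub (λ u∈ → proj₂ (boundθ _≟ᶠ_ k ps q qs r rs e U u∈))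
        E tightL (strict E (∈-resp-↭ (↭-sym perm) (∈-allFin v₀)))
      bound : Bound R (allFin n)
      bound j p I F = ≤-trans (≤-reflexive (sym (cnt-perm (3 + j) I perm)))
        (≤-trans (goodL _ refl j p I (forces-perm I perm (conn-perm id) F))
          (≤-reflexive (cong (λ m → binom (m ∸ 1) (2 + j) + bonus j) (↭-length perm))))

module _ {n : ℕ} where
  open DecMem (_≟ᶠ_ {n}) using (_∈?_) public

-- Connected sets as lists

toVec : ∀ {n} → List (Fin n) → Vec Bool n
toVec s = tabulateᵛ (λ v → does (v ∈? s))

toVec-∈ : ∀ {n} {v : Fin n} {s} → lookup (toVec s) v ≡ true → v ∈ s
toVec-∈ {v = v} {s} e = dec-true⁻ (v ∈? s) (≡-trans (sym (lookup∘tabulate _ v)) e)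

∈-toVec : ∀ {n} {v : Fin n} {s} → v ∈ s → lookup (toVec s) v ≡ true
∈-toVec {v = v} {s} m = ≡-trans (lookup∘tabulate _ v) (dec-true (v ∈? s) m)

toVec-perm : ∀ {n} {s t : List (Fin n)} → s ↭ t → toVec s ≡ toVec t
toVec-perm {s = s} {t} r = tabulate-cong λ v →
  does-⇔ (mk⇔ (∈-resp-↭ r) (∈-resp-↭ (↭-sym r))) (v ∈? s) (v ∈? t)

suc-∈⁻ : ∀ {n} {v : Fin n} {s} → Fin.suc v ∈ map suc s → v ∈ s
suc-∈⁻ m with ∈-map⁻ suc m
... | _ , m' , refl = m'

zero∉map-suc : ∀ {n} {s : List (Fin n)} → Fin.zero ∉ map suc s
zero∉map-suc m with ∈-map⁻ suc m
... | _ , _ , ()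

toVec-out : ∀ {n} (s : List (Fin n)) → toVec (map suc s) ≡ false ∷ᵛ toVec s
toVec-out s = cong₂ _∷ᵛ_ (dec-false (zero ∈? map suc s) zero∉map-suc)
  (tabulate-cong λ v → does-⇔ (mk⇔ suc-∈⁻ (∈-map⁺ suc)) (suc v ∈? map suc s) (v ∈? s))

toVec-in : ∀ {n} (s : List (Fin n)) → toVec (zero ∷ map suc s) ≡ true ∷ᵛ toVec s
toVec-in s = cong₂ _∷ᵛ_ (dec-true (zero ∈? (zero ∷ map suc s)) (here refl))
  (tabulate-cong λ v → does-⇔ (mk⇔ (suc-∈⁻ ∘ tail λ ()) (there ∘ ∈-map⁺ suc))
    (suc v ∈? (zero ∷ map suc s)) (v ∈? s))

allFin-suc : ∀ n → allFin (suc n) ≡ zero ∷ map suc (allFin n)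
allFin-suc n = cong (zero ∷_) (sym (map-tabulate id suc))

countTrue-++ : ∀ xs ys → countTrue (xs ++ ys) ≡ countTrue xs + countTrue ys
countTrue-++ []           ys = refl
countTrue-++ (true ∷ xs)  ys = cong suc (countTrue-++ xs ys)
countTrue-++ (false ∷ xs) ys = countTrue-++ xs ys

countTrue-map : {A B : Set} (f : B → Bool) (g : A → B) (h : A → Bool) → (∀ a → f (g a) ≡ h a) →
  ∀ xs → countTrue (map f (map g xs)) ≡ countTrue (map h xs)
countTrue-map f g h e xs =
  cong countTrue (≡-trans (sym (map-∘ xs)) (map-cong e xs))

countTrue-false : {A : Set} (f : A → Bool) → (∀ a → f a ≡ false) → ∀ xs → countTrue (map f xs) ≡ 0
countTrue-false f e []       = refl
countTrue-false f e (x ∷ xs) rewrite e x = countTrue-false f e xs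

-- Both enumerations branch on the first vertex, `allSubsets` through the head bit and `cnt` through
-- the head of the list; `inside` is zero at size zero because no empty set contains that vertex.
subsets-cnt : ∀ n k (q : Vec Bool n → Bool) (p : List (Fin n) → Bool) → (∀ s → p s ≡ q (toVec s)) →
  countTrue (map (λ S → (sizeV S ≡ᵇ k) ∧ q S) (allSubsets n)) ≡ cnt p k (allFin n)
subsets-cnt zero zero q p e rewrite e [] with q []ᵛ
... | true  = refl
... | false = refl
subsets-cnt zero (suc k) q p e = refl
subsets-cnt (suc n) k q p e = begin
  countTrue (map f (map (true ∷ᵛ_) S ++ map (false ∷ᵛ_) S))
    ≡⟨ cong countTrue (map-++ f (map (true ∷ᵛ_) S) (map (false ∷ᵛ_) S)) ⟩
  countTrue (map f (map (true ∷ᵛ_) S) ++ map f (map (false ∷ᵛ_) S))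
    ≡⟨ countTrue-++ (map f (map (true ∷ᵛ_) S)) _ ⟩
  countTrue (map f (map (true ∷ᵛ_) S)) + countTrue (map f (map (false ∷ᵛ_) S))
    ≡⟨ cong₂ _+_ (ins k) (≡-trans (countTrue-map f (false ∷ᵛ_) _ (λ _ → refl) S)
         (subsets-cnt n k (q ∘ (false ∷ᵛ_)) (p ∘ map suc)
           (λ s → ≡-trans (e (map suc s)) (cong q (toVec-out s))))) ⟩
  inside k + cnt (p ∘ map suc) k (allFin n) ≡⟨ join k ⟩
  cnt p k (zero ∷ map suc (allFin n)) ≡⟨ cong (cnt p k) (allFin-suc n) ⟨
  cnt p k (allFin (suc n)) ∎
  where
  open ≡-Reasoning
  S = allSubsets n
  f : Vec Bool (suc n) → Bool
  f S = (sizeV S ≡ᵇ k) ∧ q S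
  inside : ℕ → ℕ
  inside zero    = 0
  inside (suc k) = cnt (p ∘ (zero ∷_) ∘ map suc) k (allFin n)
  ins : ∀ k → countTrue (map (λ S → (sizeV S ≡ᵇ k) ∧ q S) (map (true ∷ᵛ_) S)) ≡ inside k
  ins zero = ≡-trans (countTrue-map _ (true ∷ᵛ_) _ (λ _ → refl) S) (countTrue-false _ (λ _ → refl) S)
  ins (suc k) = ≡-trans (countTrue-map _ (true ∷ᵛ_) _ (λ _ → refl) S)
    (subsets-cnt n k (q ∘ (true ∷ᵛ_)) (p ∘ (zero ∷_) ∘ map suc)
      (λ s → ≡-trans (e (zero ∷ map suc s)) (cong q (toVec-in s))))
  join : ∀ k → inside k + cnt (p ∘ map suc) k (allFin n) ≡ cnt p k (zero ∷ map suc (allFin n))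
  join zero    = refl
  join (suc k) = cong₂ _+_ (sym (cnt-map suc (p ∘ (zero ∷_)) k (allFin n)))
    (sym (cnt-map suc p (suc k) (allFin n)))

connectedSet : ∀ {n} → Adj n → List (Fin n) → Bool
connectedSet G s = connectedᵇ G (lookup (toVec s))

connectedSet-inv : ∀ {n} (G : Adj n) → Inv (connectedSet G)
connectedSet-inv G r = cong (λ S → connectedᵇ G (lookup S)) (toVec-perm r)

Sk-cnt : ∀ {n} k (G : Adj n) → Sk k G ≡ cnt (connectedSet G) k (allFin n)
Sk-cnt {n} k G = subsets-cnt n k _ _ (λ _ → refl)

≡ᵇ-refl : ∀ i → (i ≡ᵇ i) ≡ true
≡ᵇ-refl zero    = refl
≡ᵇ-refl (suc i) = ≡ᵇ-refl i

==-refl : ∀ {n} (u : Fin n) → (u == u) ≡ true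
==-refl u = ≡ᵇ-refl (toℕ u)

≡ᵇ-true⁻ : ∀ {i j} → (i ≡ᵇ j) ≡ true → i ≡ j
≡ᵇ-true⁻ {i} {j} e = ≡ᵇ⇒≡ i j (subst Data.Bool.T (sym e) tt)

chain-const : ∀ {n} (G : Adj n) (S P : Fin n → Bool) →
  (∀ {u v} → S u ≡ true → S v ≡ true → G u v ≡ true → P u ≡ P v) →
  ∀ {u} ws {v} → S u ≡ true → chain G S u ws v ≡ true → P u ≡ P v
chain-const G S P cl [] Su e = cong P (toℕ-injective (≡ᵇ-true⁻ e))
chain-const G S P cl {u} (w ∷ ws) Su e =
  let (Guw , e') = ∧-true⁻ (G u w) e ; (Sw , e'') = ∧-true⁻ (S w) e' in
  ≡-trans (cl Su Sw Guw) (chain-const G S P cl ws Sw e'')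

-- From walks to cuts: a predicate constant along the edges inside `S` is constant along every walk
-- inside `S`.
connected-sound : ∀ {n} (G : Adj n) (S : Fin n → Bool) {s} → (∀ {v} → v ∈ s → S v ≡ true) →
  (∀ {v} → S v ≡ true → v ∈ s) → connectedᵇ G S ≡ true → Conn (λ u v → G u v ≡ true) s
connected-sound {n} G S in-S of-S e P cl {u} {v} u∈ v∈
  with all-true⁻ _ (allFin n) (all-true⁻ _ (allFin n) e (∈-allFin u)) (∈-allFin v)
... | r rewrite in-S u∈ | in-S v∈ with any-true⁻ _ (upTo n) r
...   | l , _ , r' with any-true⁻ (λ ws → chain G S u ws v) (allLists n l) r'
...     | ws , _ , c = chain-const G S P (λ a b → cl (of-S a) (of-S b)) ws (in-S u∈) c

connectedSet-sound : ∀ {n} (G : Adj n) {s} → connectedSet G s ≡ true → Conn (λ u v → G u v ≡ true) s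
connectedSet-sound G = connected-sound G _ ∈-toVec toVec-∈

allLists-∈ : ∀ {n} (ws : List (Fin n)) → ws ∈ allLists n (length ws)
allLists-∈ []       = here refl
allLists-∈ {n} (w ∷ ws) = ∈-concatMap⁺ (λ w → map (w ∷_) (allLists n (length ws))) {xs = allFin n}
  (lose (∈-allFin w) (∈-map⁺ (w ∷_) (allLists-∈ ws)))

reach : ∀ {n} (G : Adj n) S {u v} ws → length ws < n → chain G S u ws v ≡ true → reachable G S u v ≡ true
reach {n} G S ws l c = any-true⁺ _ (∈-upTo⁺ l) (any-true⁺ (λ ws → chain G S _ ws _) (allLists-∈ ws) c)

-- Any two members are joined through `c` in at most two steps, which `reachable` permits as soon as
-- `n` is at least 3.
star-connected : ∀ {n} (G : Adj n) S c → 3 ≤ n → S c ≡ true →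
  (∀ {v} → S v ≡ true → v ≢ c → G c v ≡ true × G v c ≡ true) → connectedᵇ G S ≡ true
star-connected {n} G S c 3≤n Sc adj =
  all-true⁺ _ (allFin n) λ {u} _ → all-true⁺ _ (allFin n) λ {v} _ → step u v
  where
  connect : ∀ u v → S u ≡ true → S v ≡ true → reachable G S u v ≡ true
  connect u v Su Sv with u ≟ᶠ c | v ≟ᶠ c
  ... | yes refl | yes refl = reach G S [] (≤-trans (s≤s z≤n) 3≤n) (==-refl u)
  ... | yes refl | no v≢c = reach G S (v ∷ []) (≤-trans (s≤s (s≤s z≤n)) 3≤n)
    (∧-true⁺ (proj₁ (adj Sv v≢c)) (∧-true⁺ Sv (==-refl v)))
  ... | no u≢c | yes refl = reach G S (v ∷ []) (≤-trans (s≤s (s≤s z≤n)) 3≤n)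
    (∧-true⁺ (proj₂ (adj Su u≢c)) (∧-true⁺ Sv (==-refl v)))
  ... | no u≢c | no v≢c = reach G S (c ∷ v ∷ []) 3≤n
    (∧-true⁺ (proj₂ (adj Su u≢c)) (∧-true⁺ Sc
      (∧-true⁺ (proj₁ (adj Sv v≢c)) (∧-true⁺ Sv (==-refl v)))))
  step : ∀ u v → not (S u ∧ S v) ∨ reachable G S u v ≡ true
  step u v with S u in eu | S v in ev
  ... | true  | true  = connect u v eu ev
  ... | true  | false = refl
  ... | false | _     = refl

star-set : ∀ {n} (G : Adj n) c s → 3 ≤ n → c ∈ s →
  (∀ {v} → v ∈ s → v ≢ c → G c v ≡ true × G v c ≡ true) → connectedSet G s ≡ true
star-set G c s 3≤n c∈ adj = star-connected G _ c 3≤n (∈-toVec c∈) (adj ∘ toVec-∈)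

cnt-1 : {A : Set} (p : List A → Bool) → ∀ L → cnt p 1 L ≡ countTrue (map (λ a → p (a ∷ [])) L)
cnt-1 p []      = refl
cnt-1 p (a ∷ L) with p (a ∷ [])
... | true  = cong suc (cnt-1 p L)
... | false = cnt-1 p L

countTrue-concatMap : {A B : Set} (f : A → List Bool) (g : B → List Bool) (h : B → A) →
  (∀ b → countTrue (f (h b)) ≡ countTrue (g b)) →
  ∀ xs → countTrue (concatMap f (map h xs)) ≡ countTrue (concatMap g xs)
countTrue-concatMap f g h e [] = refl
countTrue-concatMap f g h e (x ∷ xs) = ≡-trans (countTrue-++ (f (h x)) _)
  (≡-trans (cong₂ _+_ (e x) (countTrue-concatMap f g h e xs)) (sym (countTrue-++ (g x) _)))

edgeCount-cnt : ∀ {n} (G : Adj n) → edgeCount G ≡ cnt (isEdge G) 2 (allFin n)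
edgeCount-cnt {zero}  G = refl
edgeCount-cnt {suc n} G = subst
  (λ L → countTrue (concatMap (λ i → map (λ j → (toℕ i <ᵇ toℕ j) ∧ G i j) L) L) ≡ cnt (isEdge G) 2 L)
  (sym (allFin-suc n)) (begin
  countTrue (row zero ++ concatMap row (map suc (allFin n)))
    ≡⟨ countTrue-++ (row zero) _ ⟩
  countTrue (row zero) + countTrue (concatMap row (map suc (allFin n)))
    ≡⟨ cong₂ _+_ first (≡-trans (countTrue-concatMap row _ suc rest (allFin n)) (edgeCount-cnt G')) ⟩
  cnt (isEdge G ∘ (zero ∷_)) 1 (map suc (allFin n)) + cnt (isEdge G') 2 (allFin n)
    ≡⟨ cong (cnt (isEdge G ∘ (zero ∷_)) 1 (map suc (allFin n)) +_)
         (≡-trans (cnt-cong _ _ 2 (allFin n) shift-edge) (sym (cnt-map suc (isEdge G) 2 (allFin n)))) ⟩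
  cnt (isEdge G ∘ (zero ∷_)) 1 (map suc (allFin n)) + cnt (isEdge G) 2 (map suc (allFin n)) ∎)
  where
  open ≡-Reasoning
  G' : Adj n
  G' i j = G (suc i) (suc j)
  row : Fin (suc n) → List Bool
  row i = map (λ j → (toℕ i <ᵇ toℕ j) ∧ G i j) (zero ∷ map suc (allFin n))
  first : countTrue (row zero) ≡ cnt (isEdge G ∘ (zero ∷_)) 1 (map suc (allFin n))
  first = ≡-trans (countTrue-map _ suc (λ j → G zero (suc j)) (λ _ → refl) (allFin n))
    (sym (≡-trans (cnt-map suc _ 1 (allFin n)) (cnt-1 _ (allFin n))))
  rest : ∀ i → countTrue (row (suc i)) ≡ countTrue (map (λ j → (toℕ i <ᵇ toℕ j) ∧ G' i j) (allFin n))
  rest i = countTrue-map _ suc _ (λ _ → refl) (allFin n)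
  shift-edge : ∀ s → isEdge G' s ≡ isEdge G (map suc s)
  shift-edge []              = refl
  shift-edge (_ ∷ [])        = refl
  shift-edge (_ ∷ _ ∷ [])    = refl
  shift-edge (_ ∷ _ ∷ _ ∷ _) = refl

leaf-nbrs : ∀ {n} (G : Adj n) sy irr {v} → degree G v ≡ 1 → ¬ twoNbrs G sy irr v
leaf-nbrs {n} G sy irr {v} d (a , b , a≢b , Ra , Rb) = contradiction
  (subst (2 ≤_) (≡-trans (cnt-1 (isEdge G ∘ (v ∷_)) (allFin n)) d)
    (2≤cnt1 (isEdge G ∘ (v ∷_)) (∈-allFin a) (∈-allFin b) a≢b Ra Rb)) λ { (s≤s ()) }

adj⁺ : ∀ {n} es {i j : Fin n} {u v} → (u , v) ∈ es →
  ((u ≡ᵇ toℕ i) ∧ (v ≡ᵇ toℕ j)) ∨ ((u ≡ᵇ toℕ j) ∧ (v ≡ᵇ toℕ i)) ≡ true → adjFromEdges es i j ≡ true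
adj⁺ es m h = any-true⁺ _ m h

-- The embedded theta graph

range : ℕ → ℕ → List ℕ
range s zero    = []
range s (suc k) = s ∷ range (suc s) k

range-++ : ∀ s a b → range s a ++ range (s + a) b ≡ range s (a + b)
range-++ s zero    b = cong (λ t → range t b) (+-identityʳ s)
range-++ s (suc a) b = cong (s ∷_)
  (≡-trans (cong (λ t → range (suc s) a ++ range t b) (+-suc s a)) (range-++ (suc s) a b))

range-∈⁻ : ∀ s k {i} → i ∈ range s k → s ≤ i × i < s + k
range-∈⁻ s (suc k) (here refl) = ≤-refl , ≤-trans (s≤s (m≤m+n s k)) (≤-reflexive (sym (+-suc s k)))
range-∈⁻ s (suc k) (there m) with range-∈⁻ (suc s) k m
... | a , b = ≤-trans (n≤1+n s) a , ≤-trans b (≤-reflexive (sym (+-suc s k)))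

range-unique : ∀ s k → Unique (range s k)
range-unique s zero    = []
range-unique s (suc k) =
  ∉⇒unique (λ m → <-irrefl refl (proj₁ (range-∈⁻ (suc s) k m))) (range-unique (suc s) k)

pathEdges-range : ∀ x y s k → pathEdges x y s k ≡ pathPairs x (range s k) y
pathEdges-range x y s zero    = refl
pathEdges-range x y s (suc k) = cong ((x , s) ∷_) (pathEdges-range s y (suc s) k)

pathPairs-map : {A B : Set} (f : A → B) → ∀ x ps y →
  pathPairs (f x) (map f ps) (f y) ≡ map (both f) (pathPairs x ps y)
pathPairs-map f x []       y = refl
pathPairs-map f x (p ∷ ps) y = cong ((f x , f p) ∷_) (pathPairs-map f p ps y)

pairsθ-map : {A B : Set} (f : A → B) → ∀ x y ps qs rs →
  pairsθ (f x) (f y) (map f ps) (map f qs) (map f rs) ≡ map (both f) (pairsθ x y ps qs rs)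
pairsθ-map f x y ps qs rs
  rewrite map-++ (both f) (pathPairs x ps y) (pathPairs x qs y ++ pathPairs x rs y)
        | map-++ (both f) (pathPairs x qs y) (pathPairs x rs y) =
  cong₂ _++_ (pathPairs-map f x ps y)
    (cong₂ _++_ (pathPairs-map f x qs y) (pathPairs-map f x rs y))

vertsθ-map : {A B : Set} (f : A → B) → ∀ x y ps qs rs →
  vertsθ (f x) (f y) (map f ps) (map f qs) (map f rs) ≡ map f (vertsθ x y ps qs rs)
vertsθ-map f x y ps qs rs rewrite map-++ f ps (qs ++ rs) | map-++ f qs rs = refl

unique-map-on : {A B : Set} (f : A → B) {L : List A} →
  (∀ {i j} → i ∈ L → j ∈ L → f i ≡ f j → i ≡ j) → Unique L → Unique (map f L)
unique-map-on f {[]}    inj U = []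
unique-map-on f {x ∷ L} inj U = ∉⇒unique out (unique-map-on f (λ a b → inj (there a) (there b)) (unique-tail U))
  where
  out : f x ∉ map f L
  out m with ∈-map⁻ f m
  ... | z , z∈ , e with inj (here refl) (there z∈) e
  ...   | refl = Unique[x∷xs]⇒x∉xs U z∈

module _ {n : ℕ} (G : Adj n) where

  -- `sub` limits the connected sets from above; `sup` feeds the edge count and the minimum degree.
  -- The two together express inducedness.
  record ThetaIn (x y : Fin n) (ps qs rs : List (Fin n)) : Set where
    field
      uniq : Unique (vertsθ x y ps qs rs)
      sub  : ∀ {u v} → u ∈ vertsθ x y ps qs rs → v ∈ vertsθ x y ps qs rs →
        G u v ≡ true → Edge (pairsθ x y ps qs rs) u v
      sup  : ∀ {a b} → (a , b) ∈ pairsθ x y ps qs rs → G a b ≡ true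

  theta-perm : ∀ {x y ps qs rs ps' qs' rs'} → vertsθ x y ps qs rs ↭ vertsθ x y ps' qs' rs' →
    pairsθ x y ps qs rs ↭ pairsθ x y ps' qs' rs' → ThetaIn x y ps qs rs → ThetaIn x y ps' qs' rs'
  theta-perm r t Θ = record
    { uniq = unique-perm r uniq
    ; sub  = λ u v e → edge-mono (∈-resp-↭ t) (sub (∈-resp-↭ (↭-sym r) u) (∈-resp-↭ (↭-sym r) v) e)
    ; sup  = sup ∘ ∈-resp-↭ (↭-sym t)
    }
    where open ThetaIn Θ

  theta-swap12 : ∀ {x y} ps qs rs → ThetaIn x y ps qs rs → ThetaIn x y qs ps rs
  theta-swap12 {x} {y} ps qs rs = theta-perm (swap12 x y ps qs rs) (shifts (pathPairs x ps y) (pathPairs x qs y))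

  theta-swap23 : ∀ {x y} ps qs rs → ThetaIn x y ps qs rs → ThetaIn x y ps rs qs
  theta-swap23 {x} {y} ps qs rs =
    theta-perm (swap23 x y ps qs rs) (++⁺ˡ (pathPairs x ps y) (++-comm (pathPairs x qs y) (pathPairs x rs y)))

  module _ {a b c : ℕ} (f : Fin (a + b + c + 2) → Fin n) (inj : Injective _≡_ _≡_ f)
           (same : ∀ i j → G3 a b c i j ≡ G (f i) (f j)) (d : Fin n) where

    private
      m : ℕ
      m = a + b + c + 2
      as bs cs W : List ℕ
      as = range 2 a
      bs = range (2 + a) b
      cs = range (2 + a + b) c
      W = vertsθ 0 1 as bs cs
      es : List (ℕ × ℕ)
      es = pathEdges 0 1 2 a ++ pathEdges 0 1 (2 + a) b ++ pathEdges 0 1 (2 + a + b) c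
      es≡ : es ≡ pairsθ 0 1 as bs cs
      es≡ = cong₂ _++_ (pathEdges-range 0 1 2 a)
        (cong₂ _++_ (pathEdges-range 0 1 (2 + a) b) (pathEdges-range 0 1 (2 + a + b) c))

    -- Extending `f` to all of ℕ keeps the three paths plain ranges of labels. The labels of the
    -- theta graph lie below `m`, so the default `d` is never reached on them.
    image : ℕ → Fin n
    image i with i <? m
    ... | yes h = f (fromℕ< h)
    ... | no _  = d

    private
      image-< : ∀ {i} (h : i < m) → image i ≡ f (fromℕ< h)
      image-< {i} h with i <? m
      ... | yes _  = refl
      ... | no ¬h = contradiction h ¬h
      W≡ : W ≡ range 0 m
      W≡ = ≡-trans (cong (λ L → 0 ∷ 1 ∷ as ++ L) (range-++ (2 + a) b c))
        (≡-trans (cong (λ L → 0 ∷ 1 ∷ L) (range-++ 2 a (b + c)))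
          (cong (range 0) (solve 3 (λ a b c → lit 2 :+ (a :+ (b :+ c)) := a :+ b :+ c :+ lit 2) refl a b c)))
      bound : ∀ {i} → i ∈ W → i < m
      bound i∈ = proj₂ (range-∈⁻ 0 m (subst (_ ∈_) W≡ i∈))
      G3-image : ∀ {i j} (h : i < m) (k : j < m) → G (image i) (image j) ≡ G3 a b c (fromℕ< h) (fromℕ< k)
      G3-image h k rewrite image-< h | image-< k = sym (same _ _)
      match : ∀ {i j u v} → ((u ≡ᵇ i) ∧ (v ≡ᵇ j)) ∨ ((u ≡ᵇ j) ∧ (v ≡ᵇ i)) ≡ true →
        (u ≡ i × v ≡ j) ⊎ (u ≡ j × v ≡ i)
      match {i} {j} {u} {v} e with (u ≡ᵇ i) ∧ (v ≡ᵇ j) in eq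
      ... | true  = let (p , q) = ∧-true⁻ (u ≡ᵇ i) eq in inj₁ (≡ᵇ-true⁻ p , ≡ᵇ-true⁻ q)
      ... | false = let (p , q) = ∧-true⁻ (u ≡ᵇ j) e in inj₂ (≡ᵇ-true⁻ p , ≡ᵇ-true⁻ q)
      edge⁻ : ∀ {i j} (h : i < m) (k : j < m) → G3 a b c (fromℕ< h) (fromℕ< k) ≡ true → Edge es i j
      edge⁻ {i} {j} h k e with any-true⁻ _ es e
      ... | (u , v) , uv∈ , t with match {toℕ (fromℕ< h)} {toℕ (fromℕ< k)} {u} {v} t
      ...   | inj₁ (refl , refl) rewrite toℕ-fromℕ< h | toℕ-fromℕ< k = inj₁ uv∈
      ...   | inj₂ (refl , refl) rewrite toℕ-fromℕ< h | toℕ-fromℕ< k = inj₂ uv∈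
      edge⁺ : ∀ {i j} (h : i < m) (k : j < m) → (i , j) ∈ es → G3 a b c (fromℕ< h) (fromℕ< k) ≡ true
      edge⁺ {i} {j} h k ij∈ = adj⁺ es ij∈ hit
        where
        hit : ((i ≡ᵇ toℕ (fromℕ< h)) ∧ (j ≡ᵇ toℕ (fromℕ< k))) ∨
              ((i ≡ᵇ toℕ (fromℕ< k)) ∧ (j ≡ᵇ toℕ (fromℕ< h))) ≡ true
        hit rewrite toℕ-fromℕ< h | toℕ-fromℕ< k | ≡ᵇ-refl i | ≡ᵇ-refl j = refl

    induced-theta : ThetaIn (image 0) (image 1) (map image as) (map image bs) (map image cs)
    induced-theta = record
      { uniq = subst Unique (sym vs≡) (unique-map-on image injective
                 (subst Unique (sym W≡) (range-unique 0 m)))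
      ; sub  = λ {u} {v} u∈ v∈ e → subst (λ T → Edge T u v) (sym ps≡)
                 (present (subst (u ∈_) vs≡ u∈) (subst (v ∈_) vs≡ v∈) e)
      ; sup  = λ {u} {v} e∈ → realised (subst ((u , v) ∈_) ps≡ e∈)
      }
      where
      vs≡ = vertsθ-map image 0 1 as bs cs
      ps≡ : pairsθ (image 0) (image 1) (map image as) (map image bs) (map image cs) ≡ map (both image) es
      ps≡ = ≡-trans (pairsθ-map image 0 1 as bs cs) (cong (map (both image)) (sym es≡))
      injective : ∀ {i j} → i ∈ W → j ∈ W → image i ≡ image j → i ≡ j
      injective i∈ j∈ e = ≡-trans (sym (toℕ-fromℕ< (bound i∈)))
        (≡-trans (cong toℕ (inj (≡-trans (sym (image-< (bound i∈))) (≡-trans e (image-< (bound j∈))))))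
          (toℕ-fromℕ< (bound j∈)))
      present : ∀ {u v} → u ∈ map image W → v ∈ map image W → G u v ≡ true → Edge (map (both image) es) u v
      present u∈ v∈ e with ∈-map⁻ image u∈ | ∈-map⁻ image v∈
      ... | i , i∈ , refl | j , j∈ , refl =
        [ inj₁ ∘ ∈-map⁺ (both image) , inj₂ ∘ ∈-map⁺ (both image) ]′
          (edge⁻ (bound i∈) (bound j∈) (≡-trans (sym (G3-image (bound i∈) (bound j∈))) e))
      realised : ∀ {u v} → (u , v) ∈ map (both image) es → G u v ≡ true
      realised e∈ with ∈-map⁻ (both image) e∈
      ... | (i , j) , ij∈ , refl with pairsθ-∈ 0 1 as bs cs (subst (_ ∈_) es≡ ij∈)
      ...   | i∈ , j∈ = ≡-trans (G3-image (bound i∈) (bound j∈)) (edge⁺ (bound i∈) (bound j∈) ij∈)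

cnt-full : {A : Set} (p : List A → Bool) → ∀ k L → (∀ s → length s ≡ k → p s ≡ true) →
  cnt p k L ≡ binom (length L) k
cnt-full p zero    L       h rewrite h [] refl = refl
cnt-full p (suc k) []      h = refl
cnt-full p (suc k) (x ∷ L) h = cong₂ _+_
  (cnt-full (p ∘ (x ∷_)) k L (λ s e → h (x ∷ s) (cong suc e))) (cnt-full p (suc k) L h)

-- The graph Bₙ

B-centre : ∀ {n} {v : Fin (suc n)} → v ≢ zero → B (suc n) zero v ≡ true × B (suc n) v zero ≡ true
B-centre {n} {zero}  v≢0 = contradiction refl v≢0
B-centre {n} {suc i} _   =
  adj⁺ es {zero} {suc i} i∈ hit , adj⁺ es {suc i} {zero} i∈ (==-refl i)
  where
  es : List (ℕ × ℕ)
  es = (1 , 2) ∷ (1 , 3) ∷ map (λ v → (0 , suc v)) (upTo n)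
  i∈ : (0 , suc (toℕ i)) ∈ es
  i∈ = there (there (∈-map⁺ {A = ℕ} {B = ℕ × ℕ} (λ v → (0 , suc v)) (∈-upTo⁺ (toℕ<n i))))
  hit : (toℕ i ≡ᵇ toℕ i) ∨ false ≡ true
  hit rewrite ≡ᵇ-refl (toℕ i) = refl

module _ (m : ℕ) where

  private
    n = 4 + m
    p = connectedSet (B n)
    L : List (Fin n)
    L = tabulate suc
    L₁ L₂ : List (Fin n)
    L₁ = tabulate (λ i → suc (suc i))
    L₂ = tabulate (λ i → suc (suc (suc i)))
    3≤n : 3 ≤ n
    3≤n = s≤s (s≤s (s≤s z≤n))
    a b w : Fin n
    a = suc zero
    b = suc (suc zero)
    w = suc (suc (suc zero))

    star-a : ∀ s → a ∈ s → (∀ {v} → v ∈ s → v ≡ a ⊎ v ≡ b ⊎ v ≡ w) → p s ≡ true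
    star-a s a∈ h = star-set (B n) a s 3≤n a∈ (λ v∈ v≢a → adj (h v∈) v≢a)
      where
      adj : ∀ {v} → v ≡ a ⊎ v ≡ b ⊎ v ≡ w → v ≢ a → B n a v ≡ true × B n v a ≡ true
      adj (inj₁ e) v≢a = contradiction e v≢a
      adj (inj₂ (inj₁ refl)) _ = refl , refl
      adj (inj₂ (inj₂ refl)) _ = refl , refl

  B-1 : cnt p 1 (allFin n) ≡ binom (length (allFin n)) 1
  B-1 = cnt-full p 1 (allFin n) λ { (v ∷ []) refl →
    star-set (B n) v (v ∷ []) 3≤n (here refl) (λ { (here e) v≢ → contradiction e v≢ }) }

  B-with-centre : ∀ k → cnt (p ∘ (zero ∷_)) k L ≡ binom (length L) k
  B-with-centre k = cnt-full (p ∘ (zero ∷_)) k L λ s _ → star-set (B n) zero (zero ∷ s) 3≤n (here refl) (λ _ → B-centre)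

  -- The n - 1 edges at the centre together with ab and aw make n + 1, the edge count of every
  -- bicyclic graph.
  B-2 : binom (length L) 1 + 2 ≤ cnt p 2 (allFin n)
  B-2 = +-mono-≤ (≤-reflexive (sym (B-with-centre 1))) (≤-trans
    (2≤cnt1 (p ∘ (a ∷_)) {L₁} {b} {w} (here refl) (there (here refl)) (λ ())
      (star-a (a ∷ b ∷ []) (here refl) λ { (here e) → inj₁ e ; (there (here e)) → inj₂ (inj₁ e) })
      (star-a (a ∷ w ∷ []) (here refl) λ { (here e) → inj₁ e ; (there (here e)) → inj₂ (inj₂ e) }))
    (m≤m+n (cnt (p ∘ (a ∷_)) 1 L₁) (cnt p 2 L₁)))

  B-3 : ∀ j → binom (length L) (2 + j) + bonus j ≤ cnt p (3 + j) (allFin n)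
  B-3 (suc j) = +-mono-≤ (≤-reflexive (sym (B-with-centre (3 + j)))) z≤n
  B-3 zero = +-mono-≤ (≤-reflexive (sym (B-with-centre 2))) (≤-trans
    (1≤cnt1 (λ s → p (a ∷ b ∷ s)) {L₂} {w} (here refl)
      (star-a (a ∷ b ∷ w ∷ []) (here refl)
        λ { (here e) → inj₁ e ; (there (here e)) → inj₂ (inj₁ e) ; (there (there (here e))) → inj₂ (inj₂ e) }))
    (≤-trans (m≤m+n (cnt (λ s → p (a ∷ b ∷ s)) 1 L₂) (cnt (p ∘ (a ∷_)) 2 L₂)) (m≤m+n _ (cnt p 3 L₁))))

-- Assembling the coefficientwise comparison

coeff-mono : (f g : ℕ → ℕ) → (∀ k → f k ≤ g k) → ∀ xs k → coeff (map f xs) k ≤ coeff (map g xs) k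
coeff-mono f g h []       k       = z≤n
coeff-mono f g h (x ∷ xs) zero    = h x
coeff-mono f g h (x ∷ xs) (suc k) = coeff-mono f g h xs k

type3-bound : ∀ {n} (G : Adj n) → 7 ≤ n → IsSimple G → IsType3 G → HasLeaf G →
  Bound (λ u v → G u v ≡ true) (allFin n)
type3-bound {n} G 7≤n (sy , irr) ((conn , count) , a , b , c , (¬ab , ¬ac , ¬bc) , f , inj , same) (v₀ , deg) =
  by-cases a b c ¬ab ¬ac ¬bc {2} {2 + a} {2 + a + b} (induced-theta G {a} {b} {c} f inj same v₀)
  where
  F = image G {a} {b} {c} f inj same v₀
  finish : ∀ {x y q r} ps qs rs → ThetaIn G x y ps (q ∷ qs) (r ∷ rs) → Bound (λ u v → G u v ≡ true) (allFin n)
  finish ps qs rs Θ = theta-bound G sy irr {ps = ps} {qs} {rs} uniq sub sup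
    (connected-sound G (λ _ → true) (λ _ → refl) (λ {v} _ → ∈-allFin v) conn)
    (≤-reflexive (≡-trans (sym (edgeCount-cnt G)) (≡-trans count (+-comm n 1))))
    (v₀ , leaf-nbrs G sy irr deg) 7≤n
    where open ThetaIn Θ
  -- A path without interior vertices is moved to the front, as the other two must be nonempty. The
  -- label offsets are generalised so that matching on the lengths leaves them alone.
  by-cases : ∀ a' b' c' → ¬ (a' ≡ 0 × b' ≡ 0) → ¬ (a' ≡ 0 × c' ≡ 0) → ¬ (b' ≡ 0 × c' ≡ 0) →
    ∀ {s t u} →
    ThetaIn G (F 0) (F 1) (map F (range s a')) (map F (range t b')) (map F (range u c')) →
    Bound (λ u v → G u v ≡ true) (allFin n)
  by-cases a' (suc b') (suc c') _ _ _ Θ = finish _ _ _ Θ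
  by-cases (suc a') zero (suc c') _ _ _ Θ = finish _ _ _ (theta-swap12 G _ _ _ Θ)
  by-cases (suc a') (suc b') zero _ _ _ Θ =
    finish _ _ _ (theta-swap12 G _ _ _ (theta-swap23 G _ _ _ Θ))
  by-cases zero zero c' h _ _ _ = contradiction (refl , refl) h
  by-cases a' zero zero _ _ h _ = contradiction (refl , refl) h
  by-cases zero b' zero _ h _ _ = contradiction (refl , refl) h

pair-edge : ∀ {n} (G : Adj n) → (∀ i j → G i j ≡ G j i) →
  Forces (connectedSet G) (λ s → isEdge G s ≡ true) 2 (allFin n)
pair-edge {n} G sy (i ∷ j ∷ []) s⊆ refl e with G i j in eq
... | true = refl
... | false = contradiction
      (conn-touch _≟ᶠ_ [] (Unique[x∷xs]⇒x∉xs (sublist-unique s⊆ (allFin⁺ n))) (here refl)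
        (λ { (here refl) → [ no-edge , no-edge ∘ ≡-trans (sy i j) ]′ }) (connectedSet-sound G e)) λ ()
  where
  no-edge : G i j ≡ true → _ ∈ []
  no-edge t = contradiction (≡-trans (sym eq) t) λ ()

theorem4p5 : (n : ℕ) (G : Adj n) → 7 ≤ n → IsSimple G → IsType3 G → HasLeaf G →
    CS G ⪯ CS (B n)
theorem4p5 (suc (suc zero)) _ (s≤s (s≤s ()))
theorem4p5 (suc (suc (suc zero))) _ (s≤s (s≤s (s≤s ())))
theorem4p5 n@(suc (suc (suc (suc m)))) G 7≤n simple type3 leafy =
    ≤-reflexive (cong suc (≡-trans (length-map _ (upTo n)) (sym (length-map _ (upTo n)))))
  , λ { zero → z≤n ; (suc k) → coeff-mono _ _ bound (upTo n) k }
  where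
  compare : ∀ k → cnt (connectedSet G) (suc k) (allFin n) ≤ cnt (connectedSet (B n)) (suc k) (allFin n)
  compare zero = ≤-trans (cnt≤binom (connectedSet G) 1 (allFin n)) (≤-reflexive (sym (B-1 m)))
  -- At size two connected sets are edges, and both graphs have n + 1 of them.
  compare (suc zero) = begin
    cnt (connectedSet G) 2 (allFin n) ≤⟨ cnt-mono (connectedSet G) (isEdge G) 2 (allFin n) (pair-edge G (proj₁ simple)) ⟩
    cnt (isEdge G) 2 (allFin n)       ≡⟨ edgeCount-cnt G ⟨
    edgeCount G                       ≡⟨ proj₂ (proj₁ type3) ⟩
    n + 1                             ≡⟨ solve 1 (λ m → lit 4 :+ m :+ lit 1 := lit 3 :+ m :+ lit 2) refl m ⟩
    3 + m + 2                         ≡⟨ cong (_+ 2) (≡-trans (binom-1 _) (length-tabulate {n = 3 + m} suc)) ⟨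
    binom (length (tabulate {n = 3 + m} Fin.suc)) 1 + 2 ≤⟨ B-2 m ⟩
    cnt (connectedSet (B n)) 2 (allFin n) ∎
    where open ≤-Reasoning
  compare (suc (suc j)) = ≤-trans
    (type3-bound G 7≤n simple type3 leafy j (connectedSet G) (connectedSet-inv G) (λ s _ _ → connectedSet-sound G))
    (B-3 m j)
  bound : ∀ k → Sk (suc k) G ≤ Sk (suc k) (B n)
  bound k = ≤-trans (≤-reflexive (Sk-cnt (suc k) G))
    (≤-trans (compare k) (≤-reflexive (sym (Sk-cnt (suc k) (B n)))))
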